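{- Let $S$ be a pairwise-intersecting double-interval society with $n\ge 1$ voters and approval number $a(S)$. Then $$a(S)\ \ge\ \left\lceil 2n+\tfrac12-\sqrt{3n^2-n+\tfrac14}\right\rceil,$$ so that $$\frac{a(S)}{n}\ \ge\ 2-\sqrt3+\frac{3+\sqrt3}{6n}-\frac{\sqrt3}{24n^2},$$ and equivalently $$n\ \le\ \left\lfloor 2a(S)-\tfrac32+\sqrt{3a(S)^2-5a(S)+\tfrac94}\right\rfloor.$$
   Context: A double-interval society consists of a finite set $V$ of $n$ voters, each voter $v$ having an approval set $A_v\subseteq\mathbb{R}$ that is the union of two disjoint bounded closed intervals. The society is pairwise-intersecting if $A_u\cap A_v\neq\emptyset$ for all voters $u,v$. For a point (platform) $p\in\mathbb{R}$, its approval number $a(p)$ is the number of voters $v$ with $p\in A_v$; the approval number of the society is $a(S)=\max_{p\in\mathbb{R}}a(p)$, and its approval ratio is $a(S)/n$. -}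

module Defs where

open import Data.Empty using (⊥)
open import Data.Fin using (Fin)
open import Data.Fin.Subset using (Subset; ∣_∣) renaming (_∈_ to _∈ˢ_)
open import Data.Integer as ℤ using (ℤ; +_; -[1+_])
import Data.Integer.Properties as ℤ
open import Data.Nat as ℕ using (ℕ; zero; suc)
import Data.Nat.Properties as ℕ
open import Data.Product using (∃; ∃-syntax; _×_; _,_; proj₁; proj₂)
open import Data.Rational as ℚ using (ℚ; 0ℚ; 1ℚ; ½; ↥_; ↧_)
import Data.Rational.Properties as ℚ
open import Data.Rational.Solver using (module +-*-Solver)
import Data.Rational.Unnormalised as ℚᵘ
import Data.Rational.Unnormalised.Properties as ℚᵘ
open import Data.Sum using (_⊎_; inj₁; inj₂; [_,_]′; swap)
open import Function using (_⇔_)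
open import Level using (0ℓ)
open import Relation.Binary using (tri<; tri≈; tri>)
open import Relation.Binary.PropositionalEquality
  using (_≡_; refl; sym; trans; cong; subst; subst₂)
open import Relation.Nullary using (yes; no; contradiction)
open import Relation.Unary using (Pred; Empty; Satisfiable; _∩_; _∪_)

ι : ℕ → ℚ
ι n = + n ℚ./ 1

toℚᵘ-/1 : ∀ i → ℚ.toℚᵘ (i ℚ./ 1) ℚᵘ.≃ ℚᵘ.mkℚᵘ i 0
toℚᵘ-/1 i = ℚ.toℚᵘ-fromℚᵘ (ℚᵘ.mkℚᵘ i 0)

ι-suc : ∀ n → ι (suc n) ≡ 1ℚ ℚ.+ ι n
ι-suc n = ℚ.toℚᵘ-injective (begin
  ℚ.toℚᵘ (ι (suc n))               ≈⟨ toℚᵘ-/1 (+ suc n) ⟩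
  ℚᵘ.mkℚᵘ (+ suc n) 0              ≈⟨ ℚᵘ.*≡* eq ⟩
  ℚᵘ.1ℚᵘ ℚᵘ.+ ℚᵘ.mkℚᵘ (+ n) 0      ≈⟨ ℚᵘ.+-congʳ ℚᵘ.1ℚᵘ (toℚᵘ-/1 (+ n)) ⟨
  ℚᵘ.1ℚᵘ ℚᵘ.+ ℚ.toℚᵘ (ι n)         ≈⟨ ℚ.toℚᵘ-homo-+ 1ℚ (ι n) ⟨
  ℚ.toℚᵘ (1ℚ ℚ.+ ι n)              ∎)
  where
  open import Relation.Binary.Reasoning.Setoid ℚᵘ.≃-setoid
  eq : + suc n ℤ.* + 1 ≡ (+ 1 ℤ.* + 1 ℤ.+ + n ℤ.* + 1) ℤ.* + 1
  eq = cong (ℤ._* + 1) (cong (λ k → ℤ.1ℤ ℤ.+ k) (sym (ℤ.*-identityʳ (+ n))))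

ι-suc-* : ∀ n s η → s ℚ.+ ι (suc n) ℚ.* η ≡ (s ℚ.+ η) ℚ.+ ι n ℚ.* η
ι-suc-* n s η = trans (cong (λ k → s ℚ.+ k ℚ.* η) (ι-suc n)) (shift s (ι n) η)
  where
  open +-*-Solver
  shift : ∀ s k η → s ℚ.+ (1ℚ ℚ.+ k) ℚ.* η ≡ (s ℚ.+ η) ℚ.+ k ℚ.* η
  shift = solve 3 (λ s k η → s :+ (con 1ℚ :+ k) :* η := (s :+ η) :+ k :* η) refl

ι-positive : ∀ n .{{_ : ℕ.NonZero n}} → ℚ.Positive (ι n)
ι-positive (suc n) = ℚ.normalize-pos (suc n) 1

≤ι∣↥∣ : ∀ p → p ℚ.≤ ι ℤ.∣ ↥ p ∣
≤ι∣↥∣ p@record{} = ℚ.toℚᵘ-cancel-≤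
  (ℚᵘ.≤-respʳ-≃ (ℚᵘ.≃-sym (toℚᵘ-/1 (+ ℤ.∣ ↥ p ∣))) (ℚᵘ.*≤* (bound (↥ p) _)))
  where
  bound : ∀ i d → i ℤ.* + 1 ℤ.≤ + ℤ.∣ i ∣ ℤ.* + suc d
  bound (+ k) d = subst₂ ℤ._≤_ (ℤ.pos-* k 1) (ℤ.pos-* k (suc d))
    (ℤ.+≤+ (ℕ.*-monoʳ-≤ k (ℕ.s≤s ℕ.z≤n)))
  bound -[1+ k ] d = ℤ.-≤+

ι*-inverse : ∀ m .{{_ : ℕ.NonZero m}} q → ∃[ r ] r ℚ.* ι m ≡ q
ι*-inverse m q = q ℚ.* (ℚ.1/ ι m) , trans (ℚ.*-assoc q _ _)
  (trans (cong (q ℚ.*_) (ℚ.*-inverseˡ (ι m))) (ℚ.*-identityʳ q))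
  where instance _ = ℚ.pos⇒nonZero (ι m) {{ι-positive m}}

archimedean : ∀ g η → 0ℚ ℚ.< η → ∃[ N ] g ℚ.≤ ι N ℚ.* η
archimedean g η 0<η = N , subst (ℚ._≤ ι N ℚ.* η) eq
  (ℚ.*-monoʳ-≤-nonNeg η {{ℚ.nonNegative (ℚ.<⇒≤ 0<η)}} (≤ι∣↥∣ p))
  where
  instance _ = ℚ.pos⇒nonZero η {{ℚ.positive 0<η}}
  p = g ℚ.* (ℚ.1/ η)
  N = ℤ.∣ ↥ p ∣
  eq : p ℚ.* η ≡ g
  eq = trans (ℚ.*-assoc g _ _)
    (trans (cong (g ℚ.*_) (ℚ.*-inverseˡ η)) (ℚ.*-identityʳ g))

halve-gap : ∀ {q r} → q ℚ.< r → ∃[ ε ] 0ℚ ℚ.< ε × (q ℚ.+ ε) ℚ.+ ε ≡ r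
halve-gap {q} {r} q<r = ½ ℚ.* (r ℚ.- q) , pos , eq
  where
  open +-*-Solver
  0<r-q : 0ℚ ℚ.< r ℚ.- q
  0<r-q = subst (ℚ._< r ℚ.- q) (ℚ.+-inverseʳ q) (ℚ.+-monoˡ-< (ℚ.- q) q<r)
  pos : 0ℚ ℚ.< ½ ℚ.* (r ℚ.- q)
  pos = ℚ.*-monoʳ-<-pos ½ 0<r-q
  eq : (q ℚ.+ ½ ℚ.* (r ℚ.- q)) ℚ.+ ½ ℚ.* (r ℚ.- q) ≡ r
  eq = solve 2 (λ q r → (q :+ con ½ :* (r :- q)) :+ con ½ :* (r :- q) := r) refl q r

+-minus : ∀ s t → s ℚ.+ (t ℚ.- s) ≡ t
+-minus = solve 2 (λ s t → s :+ (t :- s) := t) refl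
  where open +-*-Solver

+-zero-* : ∀ s η → s ℚ.+ 0ℚ ℚ.* η ≡ s
+-zero-* s η = trans (cong (s ℚ.+_) (ℚ.*-zeroˡ η)) (ℚ.+-identityʳ s)

+-gaps : ∀ s t η ε → (0ℚ ℚ.+ η) ℚ.+ η ≡ ε →
  ((s ℚ.+ t) ℚ.+ ε) ℚ.+ ε ≡ ((s ℚ.+ η) ℚ.+ η) ℚ.+ ((t ℚ.+ η) ℚ.+ η)
+-gaps s t η ε 2η≡ε = trans (cong (λ k → ((s ℚ.+ t) ℚ.+ k) ℚ.+ k)
  (trans (sym 2η≡ε) (cong (ℚ._+ η) (ℚ.+-identityˡ η)))) (regroup s t η)
  where
  open +-*-Solver
  regroup : ∀ s t η → ((s ℚ.+ t) ℚ.+ (η ℚ.+ η)) ℚ.+ (η ℚ.+ η)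
                    ≡ ((s ℚ.+ η) ℚ.+ η) ℚ.+ ((t ℚ.+ η) ℚ.+ η)
  regroup = solve 3 (λ s t η → ((s :+ t) :+ (η :+ η)) :+ (η :+ η)
                            := ((s :+ η) :+ η) :+ ((t :+ η) :+ η)) refl

square-< : ∀ {p q} → 0ℚ ℚ.< p → p ℚ.< q → p ℚ.* p ℚ.< q ℚ.* q
square-< {p} {q} 0<p p<q = ℚ.<-trans
  (ℚ.*-monoʳ-<-pos p {{ℚ.positive 0<p}} p<q)
  (ℚ.*-monoˡ-<-pos q {{ℚ.positive (ℚ.<-trans 0<p p<q)}} p<q)

-- A real is a two-sided Dedekind cut of ℚ.  Equality of reals is ≤ in both
-- directions; nothing below uses _≡_ on ℝ.
record ℝ : Set₁ where
  field
    lower upper     : ℚ → Set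
    lower-inhabited : ∃ lower
    upper-inhabited : ∃ upper
    lower-down      : ∀ {q r} → q ℚ.< r → lower r → lower q
    upper-up        : ∀ {q r} → q ℚ.< r → upper q → upper r
    lower-open      : ∀ {q} → lower q → ∃[ r ] q ℚ.< r × lower r
    upper-open      : ∀ {r} → upper r → ∃[ q ] q ℚ.< r × upper q
    disjoint        : ∀ {q} → lower q → upper q → ⊥
    located         : ∀ {q r} → q ℚ.< r → lower q ⊎ upper r

open ℝ

infix 4 _≤_

_≤_ : ℝ → ℝ → Set
x ≤ y = ∀ q → lower x q → lower y q

bracket-walk : ∀ x {η t} → 0ℚ ℚ.< η → upper x t →
  ∀ n s → lower x s → t ℚ.≤ s ℚ.+ ι n ℚ.* η →
  ∃[ s ] lower x s × upper x ((s ℚ.+ η) ℚ.+ η)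
bracket-walk x {η} {t} 0<η ut zero s ls t≤ =
  let r , s<r , lr = lower-open x ls
      t<r = ℚ.≤-<-trans (subst (t ℚ.≤_) (+-zero-* s η) t≤) s<r
  in  contradiction (upper-up x t<r ut) (disjoint x lr)
bracket-walk x {η} {t} 0<η ut (suc n) s ls t≤ =
  [ (λ l → bracket-walk x 0<η ut n (s ℚ.+ η) l (subst (t ℚ.≤_) (ι-suc-* n s η) t≤))
  , (λ u → s , ls , u)
  ]′ (located x (subst (ℚ._< (s ℚ.+ η) ℚ.+ η) (ℚ.+-identityʳ (s ℚ.+ η))
       (ℚ.+-monoʳ-< (s ℚ.+ η) 0<η)))

bracket : ∀ x {η} → 0ℚ ℚ.< η → ∃[ s ] lower x s × upper x ((s ℚ.+ η) ℚ.+ η)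
bracket x {η} 0<η =
  let s , ls = lower-inhabited x
      t , ut = upper-inhabited x
      N , t-s≤ = archimedean (t ℚ.- s) η 0<η
  in  bracket-walk x 0<η ut N s ls
        (subst (ℚ._≤ s ℚ.+ ι N ℚ.* η) (+-minus s t) (ℚ.+-monoʳ-≤ s t-s≤))

fromℚ : ℚ → ℝ
fromℚ p = record
  { lower           = ℚ._< p
  ; upper           = p ℚ.<_
  ; lower-inhabited = p ℚ.- 1ℚ , subst (p ℚ.- 1ℚ ℚ.<_) (ℚ.+-identityʳ p)
                        (ℚ.+-monoʳ-< p (ℚ.negative⁻¹ (ℚ.- 1ℚ)))
  ; upper-inhabited = p ℚ.+ 1ℚ , subst (ℚ._< p ℚ.+ 1ℚ) (ℚ.+-identityʳ p)
                        (ℚ.+-monoʳ-< p (ℚ.positive⁻¹ 1ℚ))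
  ; lower-down      = ℚ.<-trans
  ; upper-up        = λ q<r p<q → ℚ.<-trans p<q q<r
  ; lower-open      = λ q<p → ℚ.<-dense q<p
  ; upper-open      = λ p<r → let m , p<m , m<r = ℚ.<-dense p<r in m , m<r , p<m
  ; disjoint        = ℚ.<-asym
  ; located         = loc
  }
  where
  loc : ∀ {q r} → q ℚ.< r → q ℚ.< p ⊎ p ℚ.< r
  loc {q} q<r with q ℚ.<? p
  ... | yes q<p = inj₁ q<p
  ... | no  q≮p = inj₂ (ℚ.≤-<-trans (ℚ.≮⇒≥ q≮p) q<r)

fromℤ : ℤ → ℝ
fromℤ i = fromℚ (i ℚ./ 1)

infixl 6 _+_ _-_
infix  8 -_

-_ : ℝ → ℝ
- x = record
  { lower           = λ q → upper x (ℚ.- q)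
  ; upper           = λ q → lower x (ℚ.- q)
  ; lower-inhabited = let u , ux = upper-inhabited x in ℚ.- u , subst (upper x) (neg² u) ux
  ; upper-inhabited = let l , lx = lower-inhabited x in ℚ.- l , subst (lower x) (neg² l) lx
  ; lower-down      = λ q<r → upper-up x (ℚ.neg-antimono-< q<r)
  ; upper-up        = λ q<r → lower-down x (ℚ.neg-antimono-< q<r)
  ; lower-open      = λ {q} u → let s , s<-q , us = upper-open x u in
      ℚ.- s , subst (ℚ._< ℚ.- s) (sym (neg² q)) (ℚ.neg-antimono-< s<-q)
            , subst (upper x) (neg² s) us
  ; upper-open      = λ {r} l → let s , -r<s , ls = lower-open x l in
      ℚ.- s , subst (ℚ.- s ℚ.<_) (sym (neg² r)) (ℚ.neg-antimono-< -r<s)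
            , subst (lower x) (neg² s) ls
  ; disjoint        = λ u l → disjoint x l u
  ; located         = λ q<r → swap (located x (ℚ.neg-antimono-< q<r))
  }
  where
  open +-*-Solver
  neg² : ∀ q → q ≡ ℚ.- (ℚ.- q)
  neg² = solve 1 (λ q → q := :- (:- q)) refl

_+_ : ℝ → ℝ → ℝ
x + y = record
  { lower           = L
  ; upper           = U
  ; lower-inhabited =
      let s , ls = lower-inhabited x ; t , lt = lower-inhabited y
          q , q<s+t = lower-inhabited (fromℚ (s ℚ.+ t))
      in  q , s , t , ls , lt , q<s+t
  ; upper-inhabited =
      let s , us = upper-inhabited x ; t , ut = upper-inhabited y
          q , s+t<q = upper-inhabited (fromℚ (s ℚ.+ t))
      in  q , s , t , us , ut , s+t<q
  ; lower-down      = λ q<r (s , t , ls , lt , r<s+t) →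
                        s , t , ls , lt , ℚ.<-trans q<r r<s+t
  ; upper-up        = λ q<r (s , t , us , ut , s+t<q) →
                        s , t , us , ut , ℚ.<-trans s+t<q q<r
  ; lower-open      = λ (s , t , ls , lt , q<s+t) →
      let r , q<r , r<s+t = ℚ.<-dense q<s+t in r , q<r , s , t , ls , lt , r<s+t
  ; upper-open      = λ (s , t , us , ut , s+t<q) →
      let r , s+t<r , r<q = ℚ.<-dense s+t<q in r , r<q , s , t , us , ut , s+t<r
  ; disjoint        = disj
  ; located         = loc
  }
  where
  L U : ℚ → Set
  L q = ∃[ s ] ∃[ t ] lower x s × lower y t × q ℚ.< s ℚ.+ t
  U q = ∃[ s ] ∃[ t ] upper x s × upper y t × s ℚ.+ t ℚ.< q

  lower<upper : ∀ z {p q} → lower z p → upper z q → p ℚ.< q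
  lower<upper z {p} {q} lp uq with ℚ.<-cmp p q
  ... | tri< p<q _ _  = p<q
  ... | tri≈ _ refl _ = contradiction uq (disjoint z lp)
  ... | tri> _ _ q<p  = contradiction (upper-up z q<p uq) (disjoint z lp)

  disj : ∀ {q} → L q → U q → ⊥
  disj (s , t , ls , lt , q<s+t) (s′ , t′ , us′ , ut′ , s′+t′<q) = ℚ.<-asym
    (ℚ.+-mono-< (lower<upper x ls us′) (lower<upper y lt ut′)) (ℚ.<-trans s′+t′<q q<s+t)

  loc : ∀ {q r} → q ℚ.< r → L q ⊎ U r
  loc q<r = let _ , q<m , m<r = ℚ.<-dense q<r in gap m<r (halve-gap q<m)
    where
    compare : ∀ {q m r ε η s t} → m ℚ.< r →
      (q ℚ.+ ε) ℚ.+ ε ≡ m → (0ℚ ℚ.+ η) ℚ.+ η ≡ ε →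
      lower x s × upper x ((s ℚ.+ η) ℚ.+ η) → lower y t × upper y ((t ℚ.+ η) ℚ.+ η) → L q ⊎ U r
    compare {q} {ε = ε} {η} {s} {t} m<r q+2ε≡m 2η≡ε (ls , us) (lt , ut)
      with q ℚ.<? s ℚ.+ t
    ... | yes q<s+t = inj₁ (s , t , ls , lt , q<s+t)
    ... | no  q≮s+t = inj₂ (_ , _ , us , ut , ℚ.≤-<-trans
      (subst₂ ℚ._≤_ (+-gaps s t η ε 2η≡ε) q+2ε≡m
        (ℚ.+-monoˡ-≤ ε (ℚ.+-monoˡ-≤ ε (ℚ.≮⇒≥ q≮s+t)))) m<r)

    narrow : ∀ {q m r ε} → m ℚ.< r → (q ℚ.+ ε) ℚ.+ ε ≡ m →
      ∃[ η ] 0ℚ ℚ.< η × (0ℚ ℚ.+ η) ℚ.+ η ≡ ε → L q ⊎ U r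
    narrow m<r q+2ε≡m (_ , 0<η , 2η≡ε) =
      compare m<r q+2ε≡m 2η≡ε (proj₂ (bracket x 0<η)) (proj₂ (bracket y 0<η))

    gap : ∀ {q m r} → m ℚ.< r →
      ∃[ ε ] 0ℚ ℚ.< ε × (q ℚ.+ ε) ℚ.+ ε ≡ m → L q ⊎ U r
    gap m<r (_ , 0<ε , q+2ε≡m) = narrow m<r q+2ε≡m (halve-gap 0<ε)

_-_ : ℝ → ℝ → ℝ
x - y = x + (- y)

infixl 7 _÷_

_÷_ : ℝ → (m : ℕ) .{{_ : ℕ.NonZero m}} → ℝ
x ÷ m = record
  { lower           = λ q → lower x (q ℚ.* ι m)
  ; upper           = λ q → upper x (q ℚ.* ι m)
  ; lower-inhabited = let l , lx = lower-inhabited x ; q , eq = ι*-inverse m l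
                      in  q , subst (lower x) (sym eq) lx
  ; upper-inhabited = let u , ux = upper-inhabited x ; q , eq = ι*-inverse m u
                      in  q , subst (upper x) (sym eq) ux
  ; lower-down      = λ q<r → lower-down x (mono q<r)
  ; upper-up        = λ q<r → upper-up x (mono q<r)
  ; lower-open      = λ {q} l →
      let s , q*m<s , ls = lower-open x l ; r , eq = ι*-inverse m s
      in  r , cancel (subst (q ℚ.* ι m ℚ.<_) (sym eq) q*m<s) , subst (lower x) (sym eq) ls
  ; upper-open      = λ {q} u →
      let s , s<q*m , us = upper-open x u ; r , eq = ι*-inverse m s
      in  r , cancel (subst (ℚ._< q ℚ.* ι m) (sym eq) s<q*m) , subst (upper x) (sym eq) us
  ; disjoint        = disjoint x
  ; located         = λ q<r → located x (mono q<r)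
  }
  where
  mono : ∀ {q r} → q ℚ.< r → q ℚ.* ι m ℚ.< r ℚ.* ι m
  mono = ℚ.*-monoˡ-<-pos (ι m) {{ι-positive m}}
  cancel : ∀ {q r} → q ℚ.* ι m ℚ.< r ℚ.* ι m → q ℚ.< r
  cancel = ℚ.*-cancelʳ-<-nonNeg (ι m) {{ℚ.pos⇒nonNeg (ι m) {{ι-positive m}}}}

infix 9 √_

-- The cut of √x is {q | q < 0 or q² < x}, {q | 0 < q and x < q²}; asking for a
-- rational r strictly beyond q with this property gives the same sets and makes
-- openness immediate.  Negative reals are sent to 0.
√_ : ℝ → ℝ
√ x = record
  { lower           = L
  ; upper           = U
  ; lower-inhabited = ℚ.- 1ℚ , 0ℚ , ℚ.negative⁻¹ (ℚ.- 1ℚ) , inj₁ ℚ.≤-refl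
  ; upper-inhabited = inhabited
  ; lower-down      = λ q<q′ (r , q′<r , p) → r , ℚ.<-trans q<q′ q′<r , p
  ; upper-up        = λ q<q′ (r , r<q , p) → r , ℚ.<-trans r<q q<q′ , p
  ; lower-open      = λ (r , q<r , p) →
      let m , q<m , m<r = ℚ.<-dense q<r in m , q<m , r , m<r , p
  ; upper-open      = λ (r , r<q , p) →
      let m , r<m , m<q = ℚ.<-dense r<q in m , m<q , r , r<m , p
  ; disjoint        = disj
  ; located         = loc
  }
  where
  L U : ℚ → Set
  L q = ∃[ r ] q ℚ.< r × (r ℚ.≤ 0ℚ ⊎ lower x (r ℚ.* r))
  U q = ∃[ r ] r ℚ.< q × 0ℚ ℚ.< r × upper x (r ℚ.* r)

  inhabited : ∃ U
  inhabited with upper-inhabited x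
  ... | u , ux = r ℚ.+ 1ℚ , r , proj₂ (upper-inhabited (fromℚ r)) , 0<r , upper-up x u<r² ux
    where
    1≤m : 1ℚ ℚ.≤ 1ℚ ℚ.⊔ u
    1≤m = ℚ.p≤p⊔q 1ℚ u
    r = (1ℚ ℚ.⊔ u) ℚ.+ 1ℚ
    m<r : 1ℚ ℚ.⊔ u ℚ.< r
    m<r = proj₂ (upper-inhabited (fromℚ (1ℚ ℚ.⊔ u)))
    1<r : 1ℚ ℚ.< r
    1<r = ℚ.≤-<-trans 1≤m m<r
    0<r : 0ℚ ℚ.< r
    0<r = ℚ.<-trans (ℚ.positive⁻¹ 1ℚ) 1<r
    u<r : u ℚ.< r
    u<r = ℚ.≤-<-trans (ℚ.p≤q⊔p 1ℚ u) m<r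
    u<r² : u ℚ.< r ℚ.* r
    u<r² = ℚ.<-trans u<r (subst (ℚ._< r ℚ.* r) (ℚ.*-identityˡ r)
      (ℚ.*-monoˡ-<-pos r {{ℚ.positive 0<r}} 1<r))

  disj : ∀ {q} → L q → U q → ⊥
  disj (r , q<r , inj₁ r≤0) (s , s<q , 0<s , _) =
    ℚ.<-irrefl refl (ℚ.<-≤-trans (ℚ.<-trans 0<s (ℚ.<-trans s<q q<r)) r≤0)
  disj (r , q<r , inj₂ lr²) (s , s<q , 0<s , us²) =
    disjoint x lr² (upper-up x (square-< 0<s (ℚ.<-trans s<q q<r)) us²)

  loc : ∀ {q r} → q ℚ.< r → L q ⊎ U r
  loc q<r with ℚ.<-dense q<r
  ... | m , q<m , m<r with ℚ.<-dense m<r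
  ...   | m′ , m<m′ , m′<r with 0ℚ ℚ.<? m
  ...     | no  0≮m = inj₁ (m , q<m , inj₁ (ℚ.≮⇒≥ 0≮m))
  ...     | yes 0<m with located x (square-< 0<m m<m′)
  ...       | inj₁ l = inj₁ (m , q<m , inj₂ l)
  ...       | inj₂ u = inj₂ (m′ , m′<r , ℚ.<-trans 0<m m<m′ , u)

-- Ceiling and floor are not computable functions on ℝ, hence least integer
-- above / greatest integer below.
IsCeiling IsFloor : ℝ → ℤ → Set
IsCeiling x c = x ≤ fromℤ c × (∀ d → x ≤ fromℤ d → c ℤ.≤ d)
IsFloor   x f = fromℤ f ≤ x × (∀ d → fromℤ d ≤ x → d ℤ.≤ f)

record Interval : Set₁ where
  field
    left right : ℝ
    left≤right : left ≤ right

⟦_⟧ : Interval → Pred ℝ 0ℓ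
⟦ I ⟧ p = Interval.left I ≤ p × p ≤ Interval.right I

record DoubleInterval : Set₁ where
  field
    first second : Interval
    disjoint     : Empty (⟦ first ⟧ ∩ ⟦ second ⟧)

Society : ℕ → Set₁
Society n = Fin n → DoubleInterval

module _ {n : ℕ} (S : Society n) where

  approvalSet : Fin n → Pred ℝ 0ℓ
  approvalSet v = ⟦ DoubleInterval.first (S v) ⟧ ∪ ⟦ DoubleInterval.second (S v) ⟧

  PairwiseIntersecting : Set₁
  PairwiseIntersecting = ∀ u v → Satisfiable (approvalSet u ∩ approvalSet v)

  -- Membership of a real in an interval is not decidable, so a(p) = k and
  -- a(S) = a are relations rather than functions.  The subset T is the set of
  -- voters approving p.
  PointApproval : ℝ → ℕ → Set
  PointApproval p k =
    ∃[ T ] (∀ v → v ∈ˢ T ⇔ approvalSet v p) × ∣ T ∣ ≡ k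

  ApprovalNumber : ℕ → Set₁
  ApprovalNumber a =
    (∃[ p ] PointApproval p a) × (∀ p k → PointApproval p k → k ℕ.≤ a)

approvalBound : ℕ → ℝ
approvalBound n =
  fromℚ (ι 2 ℚ.* ι n ℚ.+ ½) -
  √ fromℚ (ι 3 ℚ.* (ι n ℚ.* ι n) ℚ.- ι n ℚ.+ + 1 ℚ./ 4)

ratioBound : (n : ℕ) .{{_ : ℕ.NonZero n}} → ℝ
ratioBound n =
  fromℤ (+ 2) - √3 + (fromℤ (+ 3) + √3) ÷ (6 ℕ.* n) - √3 ÷ (24 ℕ.* (n ℕ.* n))
  where
  √3 = √ fromℤ (+ 3)
  instance
    _ = ℕ.m*n≢0 6 n
    n²≢0 = ℕ.m*n≢0 n n
    _ = ℕ.m*n≢0 24 (n ℕ.* n) {{_}} {{n²≢0}}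

votersBound : ℕ → ℝ
votersBound a =
  fromℚ (ι 2 ℚ.* ι a ℚ.- + 3 ℚ./ 2) +
  √ fromℚ (ι 3 ℚ.* (ι a ℚ.* ι a) ℚ.- ι 5 ℚ.* ι a ℚ.+ + 9 ℚ./ 4)

ApprovalInequality : ℕ → ℕ → Set
ApprovalInequality n a = ∃[ c ] IsCeiling (approvalBound n) c × c ℤ.≤ + a

RatioInequality : (n : ℕ) .{{_ : ℕ.NonZero n}} → ℕ → Set
RatioInequality n a = ratioBound n ≤ fromℚ (+ a ℚ./ n)

VotersInequality : ℕ → ℕ → Set
VotersInequality n a = ∃[ f ] IsFloor (votersBound a) f × + n ℤ.≤ f

{-# OPTIONS --safe #-}

-- Under double negation, which is harmless for the inequality
-- n² + 3n + a² ≤ 4an + a between natural numbers, all endpoints may be compared.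
-- List the 2n intervals by decreasing left endpoint.  Two intersecting voters
-- have intersecting intervals, and the left endpoint of the one listed first lies
-- in the other.  Hence each of the n(n − 1)/2 pairs of voters is charged to an
-- interval, and an interval is charged at most a − 1 times (its left endpoint is
-- approved by its owner and by all voters charged) and at most as often as there
-- are intervals after it.  So n(n − 1)/2 ≤ a(a − 1)/2 + (2n − a)(a − 1), which is
-- the inequality above; the three bounds of the theorem solve it for a and for n.

module Submission where

open import Defs
open import Data.Bool using (Bool; true; false)
open import Data.Fin as Fin using (Fin)
import Data.Fin.Properties as Fin
open import Data.Fin.Subset using (Subset; ∣_∣) renaming (_∈_ to _∈ˢ_)
open import Data.Fin.Subset.Properties using (x∈p⇒∣p-x∣<∣p∣; x∈p∧x≢y⇒x∈p-y; ∣p∣≤n)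
open import Data.Integer as ℤ using (ℤ; +_; 0ℤ)
import Data.Integer.Properties as ℤ
import Data.Integer.Solver as ℤ
open import Data.List using (List; []; _∷_; _++_; length; map; filter; deduplicate; allFin; cartesianProduct)
import Data.List.Properties as List
open import Data.List.Membership.Propositional using (_∈_)
open import Data.List.Membership.Propositional.Properties
import Data.List.Membership.Setoid.Properties as Membershipₛ
open import Data.List.Relation.Binary.Permutation.Propositional using (↭-sym)
open import Data.List.Relation.Binary.Permutation.Propositional.Properties using (∈-resp-↭; ↭-length)
open import Data.List.Relation.Unary.All as All using (All; []; _∷_)
open import Data.List.Relation.Unary.AllPairs using (AllPairs; []; _∷_)
open import Data.List.Relation.Unary.Any using (here; there; index)
open import Data.List.Relation.Unary.Sorted.TotalOrder.Properties using (Sorted⇒AllPairs)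
open import Data.List.Relation.Unary.Unique.DecPropositional.Properties using (deduplicate-!)
open import Data.List.Relation.Unary.Unique.Propositional using (Unique)
import Data.List.Sort as Sort
open import Data.Nat as ℕ using (ℕ; zero; suc; NonZero; z≤n; s≤s)
import Data.Nat.Properties as ℕ
import Data.Nat.Solver as ℕ
open import Data.Product as Product using (_×_; _,_; proj₁; proj₂; ∃-syntax)
open import Data.Product.Function.NonDependent.Propositional using (_×-⇔_)
open import Data.Rational as ℚ using (ℚ; 0ℚ; 1ℚ; ½)
import Data.Rational.Properties as ℚ
import Data.Rational.Solver as ℚ
import Data.Rational.Unnormalised as ℚᵘ
import Data.Rational.Unnormalised.Properties as ℚᵘ
open import Data.Sum as Sum using (_⊎_; inj₁; inj₂; [_,_]′)
import Data.Vec as Vec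
import Data.Vec.Properties as Vec
open import Effect.Monad using (module RawMonad)
open import Function using (_⇔_; mk⇔; Equivalence; _∘_; id)
open import Function.Construct.Composition using (_⇔-∘_)
open import Function.Construct.Symmetry using (⇔-sym)
open import Function.Related.TypeIsomorphisms using (¬-cong-⇔)
open import Relation.Binary using (DecTotalOrder; Decidable)
open import Relation.Binary.PropositionalEquality
open import Relation.Nullary
open import Relation.Nullary.Decidable
  using (¬¬-excluded-middle; dec-true; _×-dec_; _⊎-dec_; ¬?; decidable-stable) renaming (map to map-dec)
open import Relation.Nullary.Negation using (¬¬-Monad; ¬¬-map)

-- Order on cuts

lower<upper : ∀ x {p q} → ℝ.lower x p → ℝ.upper x q → p ℚ.< q
lower<upper x lp uq = ℚ.≰⇒> λ q≤p →
  let r , p<r , lr = ℝ.lower-open x lp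
  in  ℝ.disjoint x lr (ℝ.upper-up x (ℚ.≤-<-trans q≤p p<r) uq)

≤-trans : ∀ x y z → x ≤ y → y ≤ z → x ≤ z
≤-trans x y z x≤y y≤z q lq = y≤z q (x≤y q lq)

-- If locatedness put some `r` of the lower cut of `y` into the upper cut of `x`, all of `x` would
-- lie below `r`, hence below `y`, against the hypothesis. So the other alternative always occurs.
≰⇒≥ : ∀ x y → ¬ x ≤ y → y ≤ x
≰⇒≥ x y x≰y q lq = let r , q<r , lr = ℝ.lower-open y lq in
  [ id , (λ ur → contradiction (λ s ls → ℝ.lower-down y (lower<upper x ls ur) lr) x≰y) ]′ (ℝ.located x q<r)

-- Counting pairs of voters

length-cartesianProduct : ∀ {A B : Set} (xs : List A) (ys : List B) →
  length (cartesianProduct xs ys) ≡ length xs ℕ.* length ys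
length-cartesianProduct []       ys = refl
length-cartesianProduct (x ∷ xs) ys = trans (List.length-++ (map (x ,_) ys))
  (cong₂ ℕ._+_ (List.length-map (x ,_) ys) (length-cartesianProduct xs ys))

-- The `n * n` codes of pairs map injectively to positions in the list, since a position determines
-- its entry.
length-covering : ∀ {n} (xs : List (Fin n × Fin n)) → (∀ p → p ∈ xs) → n ℕ.* n ℕ.≤ length xs
length-covering {n} xs cover = Fin.injective⇒≤ {f = λ i → index (cover (Fin.remQuot n i))} λ {i} {j} eq →
  trans (sym (Fin.combine-remQuot {n} n i))
    (trans (cong (Product.uncurry Fin.combine)
        (Membershipₛ.index-injective (setoid _) (cover (Fin.remQuot n i)) (cover (Fin.remQuot n j)) eq))
      (Fin.combine-remQuot {n} n j))

length≤∣∣ : ∀ {n} {T : Subset n} {vs} → Unique vs → All (_∈ˢ T) vs → length vs ℕ.≤ ∣ T ∣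
length≤∣∣ [] [] = z≤n
length≤∣∣ {T = T} {v ∷ vs} (v∉vs ∷ vs!) (v∈T ∷ vs⊆T) = ℕ.≤-<-trans
  (length≤∣∣ vs! (All.zipWith (λ (v≢w , w∈T) → x∈p∧x≢y⇒x∈p-y w∈T (v≢w ∘ sym)) (v∉vs , vs⊆T)))
  (x∈p⇒∣p-x∣<∣p∣ {x = v} {p = T} v∈T)

toSubset : ∀ {n} {P : Fin n → Set} → (∀ v → Dec (P v)) → ∃[ T ] (∀ v → v ∈ˢ T ⇔ P v)
toSubset P? = T , λ v → mk⇔ (∈⇒P v) (P⇒∈ v)
  where
  T = Vec.tabulate (does ∘ P?)
  ∈⇒P : ∀ v → v ∈ˢ T → _
  ∈⇒P v v∈T with P? v | trans (sym (Vec.lookup∘tabulate (does ∘ P?) v)) (Vec.[]=⇒lookup v∈T)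
  ... | yes p | _ = p
  P⇒∈ : ∀ v → _ → v ∈ˢ T
  P⇒∈ v p = Vec.lookup⇒[]= v T (trans (Vec.lookup∘tabulate (does ∘ P?) v) (dec-true (P? v) p))

-- Bounds the charges to the last `m` intervals of the list: the first of `suc m` intervals has `m`
-- after it, and `b` caps the charges to any one interval.
capacity : ℕ → ℕ → ℕ
capacity b zero    = 0
capacity b (suc m) = m ℕ.⊓ b ℕ.+ capacity b m

-- Weakening each minimum to its first argument leaves a triangular sum. Nothing is lost for `m` up
-- to `b + 1`, the value at which it is used.
2*capacity : ∀ b m → 2 ℕ.* capacity b m ℕ.+ m ℕ.≤ m ℕ.* m
2*capacity b zero    = z≤n
2*capacity b (suc m) = begin
  2 ℕ.* (m ℕ.⊓ b ℕ.+ c) ℕ.+ suc m          ≤⟨ ℕ.+-monoˡ-≤ (suc m) (ℕ.*-monoʳ-≤ 2 (ℕ.+-monoˡ-≤ c (ℕ.m⊓n≤m m b))) ⟩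
  2 ℕ.* (m ℕ.+ c) ℕ.+ suc m                ≡⟨ solve 2 (λ m c → con 2 :* (m :+ c) :+ (con 1 :+ m) := (con 2 :* c :+ m) :+ (con 2 :* m :+ con 1)) refl m c ⟩
  (2 ℕ.* c ℕ.+ m) ℕ.+ (2 ℕ.* m ℕ.+ 1)      ≤⟨ ℕ.+-monoˡ-≤ (2 ℕ.* m ℕ.+ 1) (2*capacity b m) ⟩
  m ℕ.* m ℕ.+ (2 ℕ.* m ℕ.+ 1)              ≡⟨ solve 1 (λ m → m :* m :+ (con 2 :* m :+ con 1) := (con 1 :+ m) :* (con 1 :+ m)) refl m ⟩
  suc m ℕ.* suc m                          ∎
  where
  open ℕ.≤-Reasoning
  open ℕ.+-*-Solver
  c = capacity b m

capacity-+ : ∀ b k m → capacity b (k ℕ.+ m) ℕ.≤ k ℕ.* b ℕ.+ capacity b m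
capacity-+ b zero    m = ℕ.≤-refl
capacity-+ b (suc k) m = ℕ.≤-trans (ℕ.+-mono-≤ (ℕ.m⊓n≤n (k ℕ.+ m) b) (capacity-+ b k m))
  (ℕ.≤-reflexive (sym (ℕ.+-assoc b (k ℕ.* b) (capacity b m))))

-- Listing the intervals by decreasing left endpoint, x ⊲ y says that the left
-- endpoint of x does not exceed the right endpoint of y; for y later in the
-- list this means that the left endpoint of x lies in y.
module _ {n} {X : Set} (owner : X → Fin n) {_⊲_ : X → X → Set} (_⊲?_ : Decidable _⊲_) where

  rival? : ∀ x y → Dec (x ⊲ y × owner y ≢ owner x)
  rival? x y = (x ⊲? y) ×-dec ¬? (owner y Fin.≟ owner x)

  -- Deduplicated because the test is made interval by interval, whereas approval numbers count
  -- voters.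
  rivals : X → List X → List (Fin n)
  rivals x ys = deduplicate Fin._≟_ (map owner (filter (rival? x) ys))

  edges : List X → List (Fin n × Fin n)
  edges []       = []
  edges (x ∷ xs) = map (owner x ,_) (rivals x xs) ++ edges xs

  ∈-rivals⁺ : ∀ {x y ys} → y ∈ ys → x ⊲ y → owner y ≢ owner x → owner y ∈ rivals x ys
  ∈-rivals⁺ {x} y∈ys x⊲y y≢x = ∈-deduplicate⁺ Fin._≟_ (∈-map⁺ owner (∈-filter⁺ (rival? x) y∈ys (x⊲y , y≢x)))

  ∈-rivals⁻ : ∀ {x v} ys → v ∈ rivals x ys → ∃[ y ] y ∈ ys × x ⊲ y × owner y ≢ owner x × v ≡ owner y
  ∈-rivals⁻ {x} ys v∈ with ∈-map⁻ owner (∈-deduplicate⁻ Fin._≟_ _ v∈)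
  ... | y , y∈ , v≡y with ∈-filter⁻ (rival? x) {xs = ys} y∈
  ...   | y∈ys , x⊲y , y≢x = y , y∈ys , x⊲y , y≢x , v≡y

  rivals-! : ∀ x ys → Unique (rivals x ys)
  rivals-! x ys = deduplicate-! Fin._≟_ (map owner (filter (rival? x) ys))

  length-rivals : ∀ x ys → length (rivals x ys) ℕ.≤ length ys
  length-rivals x ys = begin
    length (rivals x ys)                        ≤⟨ List.length-deduplicate Fin._≟_ (map owner (filter (rival? x) ys)) ⟩
    length (map owner (filter (rival? x) ys))   ≡⟨ List.length-map owner (filter (rival? x) ys) ⟩
    length (filter (rival? x) ys)               ≤⟨ List.length-filter (rival? x) ys ⟩
    length ys                                   ∎
    where open ℕ.≤-Reasoning

  -- Both relations are assumed because the order of `x` and `y` in the list is unknown; the one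
  -- starting from the earlier entry produces the edge.
  ∈-edges : ∀ {xs x y} → x ∈ xs → y ∈ xs → owner x ≢ owner y → x ⊲ y → y ⊲ x →
    (owner x , owner y) ∈ edges xs ⊎ (owner y , owner x) ∈ edges xs
  ∈-edges (here refl) (here refl) x≢y _ _ = contradiction refl x≢y
  ∈-edges (here refl) (there y∈) x≢y x⊲y _ = inj₁ (∈-++⁺ˡ (∈-map⁺ _ (∈-rivals⁺ y∈ x⊲y (x≢y ∘ sym))))
  ∈-edges (there x∈) (here refl) x≢y _ y⊲x = inj₂ (∈-++⁺ˡ (∈-map⁺ _ (∈-rivals⁺ x∈ y⊲x x≢y)))
  ∈-edges (there x∈) (there y∈) x≢y x⊲y y⊲x = Sum.map (∈-++⁺ʳ _) (∈-++⁺ʳ _) (∈-edges x∈ y∈ x≢y x⊲y y⊲x)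

  -- `R` stands for the sorting order: it tells how a head compares with all later entries, which is
  -- what caps its rivals by `b`.
  length-edges : ∀ {b} {R : X → X → Set} {xs} → (∀ {x ys} → All (R x) ys → length (rivals x ys) ℕ.≤ b) →
    AllPairs R xs → length (edges xs) ℕ.≤ capacity b (length xs)
  length-edges bound [] = z≤n
  length-edges {b} {xs = x ∷ xs} bound (r ∷ rs) = begin
    length (map (owner x ,_) (rivals x xs) ++ edges xs)        ≡⟨ List.length-++ (map (owner x ,_) (rivals x xs)) ⟩
    length (map (owner x ,_) (rivals x xs)) ℕ.+ length (edges xs)
      ≡⟨ cong (ℕ._+ length (edges xs)) (List.length-map _ (rivals x xs)) ⟩
    length (rivals x xs) ℕ.+ length (edges xs)
      ≤⟨ ℕ.+-mono-≤ (ℕ.⊓-glb (length-rivals x xs) (bound r)) (length-edges bound rs) ⟩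
    length xs ℕ.⊓ b ℕ.+ capacity b (length xs)                 ∎
    where open ℕ.≤-Reasoning

-- The edges, their reversals and the diagonal together cover all ordered pairs. Repeated edges do
-- no harm to this lower bound.
length-complete : ∀ {n} {es : List (Fin n × Fin n)} →
  (∀ u v → u ≢ v → (u , v) ∈ es ⊎ (v , u) ∈ es) → n ℕ.* n ℕ.≤ 2 ℕ.* length es ℕ.+ n
length-complete {n} {es} complete = begin
  n ℕ.* n                                                   ≤⟨ length-covering _ cover ⟩
  length (es ++ map Product.swap es ++ map diagonal (allFin n))  ≡⟨ List.length-++ es ⟩
  length es ℕ.+ length (map Product.swap es ++ map diagonal (allFin n))
    ≡⟨ cong (length es ℕ.+_) (List.length-++ (map Product.swap es)) ⟩
  length es ℕ.+ (length (map Product.swap es) ℕ.+ length (map diagonal (allFin n)))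
    ≡⟨ cong₂ (λ i j → length es ℕ.+ (i ℕ.+ j)) (List.length-map _ es)
         (trans (List.length-map _ (allFin n)) (List.length-tabulate {n = n} id)) ⟩
  length es ℕ.+ (length es ℕ.+ n)                           ≡⟨ solve 2 (λ l n → l :+ (l :+ n) := con 2 :* l :+ n) refl (length es) n ⟩
  2 ℕ.* length es ℕ.+ n                                     ∎
  where
  open ℕ.≤-Reasoning
  open ℕ.+-*-Solver
  diagonal : Fin n → Fin n × Fin n
  diagonal v = v , v
  cover : ∀ p → p ∈ es ++ map Product.swap es ++ map diagonal (allFin n)
  cover (u , v) with u Fin.≟ v
  ... | yes refl = ∈-++⁺ʳ es (∈-++⁺ʳ (map Product.swap es) (∈-map⁺ diagonal (∈-allFin u)))
  ... | no  u≢v  = [ ∈-++⁺ˡ , ∈-++⁺ʳ es ∘ ∈-++⁺ˡ ∘ ∈-map⁺ Product.swap ]′ (complete u v u≢v)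

-- A quantifier over `Fin n` is a finite product, and double negation is applicative.
¬¬-∀Fin : ∀ {n} {P : Fin n → Set} → (∀ i → ¬ ¬ P i) → ¬ ¬ (∀ i → P i)
¬¬-∀Fin = Fin.sequence (RawMonad.rawApplicative ¬¬-Monad)

¬¬-∀Slot : ∀ {n} {P : Fin n × Bool → Set} → (∀ x → ¬ ¬ P x) → ¬ ¬ (∀ x → P x)
¬¬-∀Slot ¬¬P = ¬¬-map (λ { f (v , true) → proj₁ (f v) ; f (v , false) → proj₂ (f v) })
  (¬¬-∀Fin λ v ¬P → ¬¬P (v , true) λ p → ¬¬P (v , false) λ q → ¬P (p , q))

-- The `2n` intervals are split into the first `k = 2n - a`, charged at most `a - 1` times each, and
-- the last `a`, charged at most `a(a - 1)/2` times in all.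
quadratic-ℕ : ∀ n a e → a ℕ.≤ n → 1 ℕ.≤ a → n ℕ.* n ℕ.≤ 2 ℕ.* e ℕ.+ n → e ℕ.≤ capacity (a ℕ.∸ 1) (n ℕ.* 2) →
  n ℕ.* n ℕ.+ 3 ℕ.* n ℕ.+ a ℕ.* a ℕ.≤ 4 ℕ.* a ℕ.* n ℕ.+ a
quadratic-ℕ n (suc b) e a≤n _ n²≤ e≤ = ℕ.+-cancelʳ-≤ a _ _ (begin
  -- The extra `a` on both sides pairs with `2c`, so that `2*capacity` applies without subtraction.
  n ℕ.* n ℕ.+ 3 ℕ.* n ℕ.+ a ℕ.* a ℕ.+ a                   ≤⟨ ℕ.+-monoˡ-≤ a (ℕ.+-monoˡ-≤ (a ℕ.* a) (ℕ.+-monoˡ-≤ (3 ℕ.* n) n²≤)) ⟩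
  2 ℕ.* e ℕ.+ n ℕ.+ 3 ℕ.* n ℕ.+ a ℕ.* a ℕ.+ a
    ≤⟨ ℕ.+-monoˡ-≤ a (ℕ.+-monoˡ-≤ (a ℕ.* a) (ℕ.+-monoˡ-≤ (3 ℕ.* n) (ℕ.+-monoˡ-≤ n (ℕ.*-monoʳ-≤ 2 e≤c)))) ⟩
  2 ℕ.* (k ℕ.* b ℕ.+ c) ℕ.+ n ℕ.+ 3 ℕ.* n ℕ.+ a ℕ.* a ℕ.+ a
    ≡⟨ solve 5 (λ k b c n a → con 2 :* (k :* b :+ c) :+ n :+ con 3 :* n :+ a :* a :+ a
                := (con 2 :* c :+ a) :+ (con 2 :* (k :* b) :+ con 2 :* (n :* con 2) :+ a :* a)) refl k b c n a ⟩
  (2 ℕ.* c ℕ.+ a) ℕ.+ (2 ℕ.* (k ℕ.* b) ℕ.+ 2 ℕ.* (n ℕ.* 2) ℕ.+ a ℕ.* a)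
    ≤⟨ ℕ.+-monoˡ-≤ _ (2*capacity b a) ⟩
  a ℕ.* a ℕ.+ (2 ℕ.* (k ℕ.* b) ℕ.+ 2 ℕ.* (n ℕ.* 2) ℕ.+ a ℕ.* a)
    ≡⟨ cong (λ m → a ℕ.* a ℕ.+ (2 ℕ.* (k ℕ.* b) ℕ.+ 2 ℕ.* m ℕ.+ a ℕ.* a)) (sym k+a) ⟩
  a ℕ.* a ℕ.+ (2 ℕ.* (k ℕ.* b) ℕ.+ 2 ℕ.* (k ℕ.+ a) ℕ.+ a ℕ.* a)
    ≡⟨ solve 2 (λ k b → let a = con 1 :+ b in
         a :* a :+ (con 2 :* (k :* b) :+ con 2 :* (k :+ a) :+ a :* a) := con 2 :* a :* (k :+ a) :+ a :+ a) refl k b ⟩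
  2 ℕ.* a ℕ.* (k ℕ.+ a) ℕ.+ a ℕ.+ a                        ≡⟨ cong (λ m → 2 ℕ.* a ℕ.* m ℕ.+ a ℕ.+ a) k+a ⟩
  2 ℕ.* a ℕ.* (n ℕ.* 2) ℕ.+ a ℕ.+ a
    ≡⟨ solve 2 (λ a n → con 2 :* a :* (n :* con 2) :+ a :+ a := con 4 :* a :* n :+ a :+ a) refl a n ⟩
  4 ℕ.* a ℕ.* n ℕ.+ a ℕ.+ a                                ∎)
  where
  open ℕ.≤-Reasoning
  open ℕ.+-*-Solver
  a = suc b
  k = n ℕ.* 2 ℕ.∸ a
  c = capacity b a
  k+a : k ℕ.+ a ≡ n ℕ.* 2
  k+a = ℕ.m∸n+n≡m (ℕ.≤-trans a≤n (ℕ.m≤m*n n 2))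
  e≤c : e ℕ.≤ k ℕ.* b ℕ.+ c
  e≤c = ℕ.≤-trans e≤ (subst (λ m → capacity b m ℕ.≤ k ℕ.* b ℕ.+ c) k+a (capacity-+ b k a))

-- The intervals of a society

module _ {n} (S : Society n) where

  interval : Fin n × Bool → Interval
  interval (v , false) = DoubleInterval.first (S v)
  interval (v , true)  = DoubleInterval.second (S v)

  left right : Fin n × Bool → ℝ
  left  x = Interval.left (interval x)
  right x = Interval.right (interval x)

  approvedIn : ∀ {v} p → approvalSet S v p → ∃[ b ] ⟦ interval (v , b) ⟧ p
  approvedIn p (inj₁ p∈) = false , p∈
  approvedIn p (inj₂ p∈) = true , p∈

  ownerApproves : ∀ x p → ⟦ interval x ⟧ p → approvalSet S (proj₁ x) p
  ownerApproves (v , false) p = inj₁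
  ownerApproves (v , true)  p = inj₂

  module _ (_≤left?_ : ∀ x y → Dec (left x ≤ left y)) (_≤right?_ : ∀ x y → Dec (left x ≤ right y)) where

    -- The order is reversed so that sorting lists left endpoints decreasingly. Intervals with the
    -- same left endpoint count as equal, which makes antisymmetry immediate.
    byLeft : DecTotalOrder _ _ _
    byLeft = record
      { Carrier = Fin n × Bool
      ; _≈_ = λ x y → left y ≤ left x × left x ≤ left y
      ; _≤_ = λ x y → left y ≤ left x
      ; isDecTotalOrder = record
        { isTotalOrder = record
          { isPartialOrder = record
            { isPreorder = record
              { isEquivalence = record
                { refl  = (λ _ l → l) , (λ _ l → l)
                ; sym   = λ (p , q) → q , p
                ; trans = λ {x} {y} {z} (p , q) (r , s) →
                    ≤-trans (left z) (left y) (left x) r p , ≤-trans (left x) (left y) (left z) q s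
                }
              ; reflexive = proj₁
              ; trans = λ {x} {y} {z} p q → ≤-trans (left z) (left y) (left x) q p
              }
            ; antisym = _,_
            }
          ; total = total
          }
        ; _≟_  = λ x y → (y ≤left? x) ×-dec (x ≤left? y)
        ; _≤?_ = λ x y → y ≤left? x
        }
      }
      where
      total : ∀ x y → left y ≤ left x ⊎ left x ≤ left y
      total x y with y ≤left? x
      ... | yes y≤x = inj₁ y≤x
      ... | no  y≰x = inj₂ (≰⇒≥ (left y) (left x) y≰x)

    slots : List (Fin n × Bool)
    slots = cartesianProduct (allFin n) (false ∷ true ∷ [])

    sorted : List (Fin n × Bool)
    sorted = Sort.sort byLeft slots

    ∈-sorted : ∀ x → x ∈ sorted
    ∈-sorted (v , b) = ∈-resp-↭ (↭-sym (Sort.sort-↭ byLeft slots)) (∈-cartesianProduct⁺ (∈-allFin v) (∈-Bool b))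
      where
      ∈-Bool : ∀ b → b ∈ false ∷ true ∷ []
      ∈-Bool false = here refl
      ∈-Bool true  = there (here refl)

    length-sorted : length sorted ≡ n ℕ.* 2
    length-sorted = trans (↭-length (Sort.sort-↭ byLeft slots))
      (trans (length-cartesianProduct (allFin n) (false ∷ true ∷ []))
        (cong (ℕ._* 2) (List.length-tabulate {n = n} id)))

    approves? : ∀ x v → Dec (approvalSet S v (left x))
    approves? x v = inside (v , false) ⊎-dec inside (v , true)
      where
      inside : ∀ y → Dec (⟦ interval y ⟧ (left x))
      inside y = (y ≤left? x) ×-dec (x ≤right? y)

    module _ {a} (maximal : ∀ p k → PointApproval S p k → k ℕ.≤ a) where

      length-rivals<a : ∀ {x ys} → All (λ y → left y ≤ left x) ys → length (rivals proj₁ _≤right?_ x ys) ℕ.< a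
      length-rivals<a {x} {ys} left≤ =
        let T , T⇔ = toSubset (approves? x) in
        -- The owner of `x` is put in front of its rivals; this additional approver makes the
        -- inequality strict.
        ℕ.≤-trans (length≤∣∣ {T = T} (fresh ∷ rivals-! proj₁ _≤right?_ x ys)
          (Equivalence.from (T⇔ _) (ownerApproves x (left x) ((λ _ l → l) , Interval.left≤right (interval x)))
            ∷ All.tabulate λ v∈ → Equivalence.from (T⇔ _) (approves v∈)))
          (maximal (left x) ∣ T ∣ (T , T⇔ , refl))
        where
        fresh : All (proj₁ x ≢_) (rivals proj₁ _≤right?_ x ys)
        fresh = All.tabulate λ v∈ → let _ , _ , _ , y≢x , v≡y = ∈-rivals⁻ proj₁ _≤right?_ ys v∈ in
          λ x≡v → y≢x (sym (trans x≡v v≡y))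
        approves : ∀ {v} → v ∈ rivals proj₁ _≤right?_ x ys → approvalSet S v (left x)
        approves v∈ with ∈-rivals⁻ proj₁ _≤right?_ ys v∈
        ... | y , y∈ , x≤y , _ , refl = ownerApproves y (left x) (All.lookup left≤ y∈ , x≤y)

      module _ (intersecting : PairwiseIntersecting S) where

        edges-complete : ∀ u v → u ≢ v →
          (u , v) ∈ edges proj₁ _≤right?_ sorted ⊎ (v , u) ∈ edges proj₁ _≤right?_ sorted
        edges-complete u v u≢v with intersecting u v
        ... | p , p∈u , p∈v with approvedIn p p∈u | approvedIn p p∈v
        ... | b , lu≤p , p≤ru | c , lv≤p , p≤rv = ∈-edges proj₁ _≤right?_ (∈-sorted (u , b)) (∈-sorted (v , c)) u≢v
          (≤-trans (left (u , b)) p (right (v , c)) lu≤p p≤rv)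
          (≤-trans (left (v , c)) p (right (u , b)) lv≤p p≤ru)

        quadratic-decided : .{{_ : NonZero n}} → a ℕ.≤ n → n ℕ.* n ℕ.+ 3 ℕ.* n ℕ.+ a ℕ.* a ℕ.≤ 4 ℕ.* a ℕ.* n ℕ.+ a
        quadratic-decided a≤n = quadratic-ℕ n a (length (edges proj₁ _≤right?_ sorted)) a≤n
          -- With no later intervals the lemma still counts the owner, so one existing voter gives
          -- `1 ≤ a`.
          (ℕ.≤-trans (s≤s z≤n) (length-rivals<a {x = v₀ , false} {[]} []))
          (length-complete edges-complete)
          (subst (λ m → length (edges proj₁ _≤right?_ sorted) ℕ.≤ capacity (a ℕ.∸ 1) m) length-sorted
            (length-edges proj₁ _≤right?_ (λ r → ℕ.∸-monoˡ-≤ 1 (length-rivals<a r))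
              (Sorted⇒AllPairs (DecTotalOrder.totalOrder byLeft) (Sort.sort-↗ byLeft slots))))
          where
          v₀ : Fin n
          v₀ = Fin.fromℕ< (ℕ.>-nonZero⁻¹ n)

  quadratic-bound : ∀ {a} .{{_ : NonZero n}} → PairwiseIntersecting S → ApprovalNumber S a →
    n ℕ.* n ℕ.+ 3 ℕ.* n ℕ.+ a ℕ.* a ℕ.≤ 4 ℕ.* a ℕ.* n ℕ.+ a
  quadratic-bound {a} intersecting ((p , T , _ , ∣T∣≡a) , maximal) = decidable-stable (_ ℕ.≤? _) (¬¬-map
    (λ dec → quadratic-decided (λ x y → proj₁ (dec x y)) (λ x y → proj₂ (dec x y)) maximal intersecting
      (subst (ℕ._≤ n) ∣T∣≡a (∣p∣≤n T)))
    -- Finitely many comparisons are decided at once under double negation, which `decidable-stable`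
    -- then removes from the numerical conclusion.
    (¬¬-∀Slot λ x → ¬¬-∀Slot λ y ¬dec →
      ¬¬-excluded-middle λ l → ¬¬-excluded-middle λ r → ¬dec (l , r)))

-- Comparing cuts with rationals

<⇒0<- : ∀ {p q} → p ℚ.< q → 0ℚ ℚ.< q ℚ.- p
<⇒0<- {p} {q} p<q = subst (ℚ._< q ℚ.- p) (ℚ.+-inverseʳ p) (ℚ.+-monoˡ-< (ℚ.- p) p<q)

0<-⇒< : ∀ {p q} → 0ℚ ℚ.< q ℚ.- p → p ℚ.< q
0<-⇒< {p} {q} 0<q-p = subst₂ ℚ._<_ (ℚ.+-identityʳ p) (+-minus p q) (ℚ.+-monoʳ-< p 0<q-p)

*-pos : ∀ {p q} → 0ℚ ℚ.< p → 0ℚ ℚ.< q → 0ℚ ℚ.< p ℚ.* q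
*-pos {p} {q} 0<p 0<q = subst (ℚ._< p ℚ.* q) (ℚ.*-zeroʳ p) (ℚ.*-monoʳ-<-pos p {{ℚ.positive 0<p}} 0<q)

-- Openness of the upper cut gives one direction and locatedness the other. Comparisons with
-- rationals thus reduce to membership in open cuts, which can be computed through sums and roots.
fromℚ≤⇔ : ∀ w y → fromℚ w ≤ y ⇔ (¬ ℝ.upper y w)
fromℚ≤⇔ w y = mk⇔
  (λ w≤y uw → let q , q<w , uq = ℝ.upper-open y uw in ℝ.disjoint y (w≤y q q<w) uq)
  (λ ¬uw q q<w → [ id , (λ uw → contradiction uw ¬uw) ]′ (ℝ.located y q<w))

≤fromℚ⇔ : ∀ x d → x ≤ fromℚ d ⇔ (¬ ℝ.lower x d)
≤fromℚ⇔ x d = mk⇔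
  (λ x≤d ld → ℚ.<-irrefl refl (x≤d d ld))
  (λ ¬ld q lq → ℚ.≰⇒> λ d≤q →
    let r , q<r , lr = ℝ.lower-open x lq in ¬ld (ℝ.lower-down x (ℚ.≤-<-trans d≤q q<r) lr))

<-by : ∀ {x p q} → 0ℚ ℚ.< x → x ≡ q ℚ.- p → p ℚ.< q
<-by 0<x refl = 0<-⇒< 0<x

module _ where
  open ℚ.+-*-Solver

  neg² : ∀ r → r ≡ ℚ.- (ℚ.- r)
  neg² = solve 1 (λ r → r := :- (:- r)) refl

  cancel-+ : ∀ q r → q ≡ (q ℚ.+ r) ℚ.+ (ℚ.- r)
  cancel-+ = solve 2 (λ q r → q := (q :+ r) :+ (:- r)) refl

  swap-minus : ∀ p q r → (p ℚ.- q) ℚ.- r ≡ (p ℚ.- r) ℚ.- q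
  swap-minus = solve 3 (λ p q r → (p :- q) :- r := (p :- r) :- q) refl

  minus-+ : ∀ p q r → (p ℚ.- r) ℚ.- q ≡ p ℚ.- (q ℚ.+ r)
  minus-+ = solve 3 (λ p q r → (p :- r) :- q := p :- (q :+ r)) refl

  regroup-lower : ∀ s t p d → (p ℚ.- s) ℚ.+ ((s ℚ.+ t) ℚ.- d) ≡ (p ℚ.- d) ℚ.- (ℚ.- t)
  regroup-lower = solve 4 (λ s t p d → (p :- s) :+ ((s :+ t) :- d) := (p :- d) :- (:- t)) refl

  regroup-upper : ∀ s t p d → (s ℚ.- p) ℚ.+ (d ℚ.- (s ℚ.+ t)) ≡ (d ℚ.- p) ℚ.- t
  regroup-upper = solve 4 (λ s t p d → (s :- p) :+ (d :- (s :+ t)) := (d :- p) :- t) refl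

lower-fromℚ-⇔ : ∀ p y d → ℝ.lower (fromℚ p - y) d ⇔ ℝ.upper y (p ℚ.- d)
lower-fromℚ-⇔ p y d = mk⇔
  (λ (s , t , s<p , ut , d<s+t) → ℝ.upper-up y
    (<-by (ℚ.+-mono-< (<⇒0<- s<p) (<⇒0<- d<s+t)) (regroup-lower s t p d)) ut)
  -- Openness leaves room for `q` between `d` and `p - r`; the summands `q + r` and `- r` then add
  -- up to `q`, above `d`.
  (λ u → let r , r<p-d , ur = ℝ.upper-open y u
             q , d<q , q<p-r = ℚ.<-dense {d} {p ℚ.- r} (<-by (<⇒0<- r<p-d) (swap-minus p d r))
         in q ℚ.+ r , ℚ.- r
          , <-by (<⇒0<- q<p-r) (minus-+ p q r)
          , subst (ℝ.upper y) (neg² r) ur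
          , subst (d ℚ.<_) (cancel-+ q r) d<q)

upper-fromℚ+⇔ : ∀ p y d → ℝ.upper (fromℚ p + y) d ⇔ ℝ.upper y (d ℚ.- p)
upper-fromℚ+⇔ p y d = mk⇔
  (λ (s , t , p<s , ut , s+t<d) → ℝ.upper-up y
    (<-by (ℚ.+-mono-< (<⇒0<- p<s) (<⇒0<- s+t<d)) (regroup-upper s t p d)) ut)
  (λ u → let r , r<d-p , ur = ℝ.upper-open y u
             q , p<q , q<d-r = ℚ.<-dense {p} {d ℚ.- r} (<-by (<⇒0<- r<d-p) (swap-minus d p r))
         in q , r , p<q , ur , <-by (<⇒0<- q<d-r) (minus-+ d q r))

-- With g = w² − D, the root e = 2w³/(g + 2w²) lies in (0, w) and satisfies
-- e² − D = g²/(g + 2w²) + (w − e)².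
root-below : ∀ D w → 0ℚ ℚ.< w → D ℚ.< w ℚ.* w → ∃[ e ] e ℚ.< w × 0ℚ ℚ.< e × D ℚ.< e ℚ.* e
root-below D w 0<w D<w² = go (ℚ.1/ K) (ℚ.positive⁻¹ (ℚ.1/ K) {{ℚ.1/pos⇒pos K}}) (ℚ.*-inverseʳ K)
  where
  open ℚ.+-*-Solver
  g = w ℚ.* w ℚ.- D
  v = w ℚ.* w ℚ.+ w ℚ.* w
  K = g ℚ.+ v
  0<g : 0ℚ ℚ.< g
  0<g = <⇒0<- D<w²
  0<v : 0ℚ ℚ.< v
  0<v = ℚ.+-mono-< (*-pos 0<w 0<w) (*-pos 0<w 0<w)
  instance
    K-pos : ℚ.Positive K
    K-pos = ℚ.positive (ℚ.+-mono-< 0<g 0<v)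
    K≢0 : ℚ.NonZero K
    K≢0 = ℚ.pos⇒nonZero K

  gap : ∀ g v w i → g ℚ.* w ℚ.* i ≡ w ℚ.* ((g ℚ.+ v) ℚ.* i) ℚ.- v ℚ.* w ℚ.* i
  gap = solve 4 (λ g v w i → g :* w :* i := w :* ((g :+ v) :* i) :- v :* w :* i) refl

  square-gap : ∀ g w k i → g ℚ.* g ℚ.* i ℚ.+ (g ℚ.* w ℚ.* i) ℚ.* (g ℚ.* w ℚ.* i) ≡
    g ℚ.* ((g ℚ.+ k) ℚ.* i) ℚ.- (k ℚ.* g ℚ.* i) ℚ.+ (g ℚ.* w ℚ.* i) ℚ.* (g ℚ.* w ℚ.* i)
  square-gap = solve 4 (λ g w k i → g :* g :* i :+ (g :* w :* i) :* (g :* w :* i)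
    := g :* ((g :+ k) :* i) :- (k :* g :* i) :+ (g :* w :* i) :* (g :* w :* i)) refl

  double-gap : ∀ g w i → (w ℚ.* w ℚ.+ w ℚ.* w) ℚ.* g ℚ.* i ≡ w ℚ.* (g ℚ.* w ℚ.* i) ℚ.+ w ℚ.* (g ℚ.* w ℚ.* i)
  double-gap = solve 3 (λ g w i → (w :* w :+ w :* w) :* g :* i := w :* (g :* w :* i) :+ w :* (g :* w :* i)) refl

  square-diff : ∀ D w e → w ℚ.* w ℚ.- D ℚ.- (w ℚ.* (w ℚ.- e) ℚ.+ w ℚ.* (w ℚ.- e)) ℚ.+ (w ℚ.- e) ℚ.* (w ℚ.- e) ≡ e ℚ.* e ℚ.- D
  square-diff = solve 3 (λ D w e → w :* w :- D :- (w :* (w :- e) :+ w :* (w :- e)) :+ (w :- e) :* (w :- e) := e :* e :- D) refl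

  go : ∀ i → 0ℚ ℚ.< i → K ℚ.* i ≡ 1ℚ → ∃[ e ] e ℚ.< w × 0ℚ ℚ.< e × D ℚ.< e ℚ.* e
  go i 0<i Ki = e
    , <-by 0<δ w-e
    , *-pos (*-pos 0<v 0<w) 0<i
    , <-by (ℚ.+-mono-< (*-pos (*-pos 0<g 0<g) 0<i) (*-pos 0<δ 0<δ)) e²-D
    where
    e = v ℚ.* w ℚ.* i
    δ = g ℚ.* w ℚ.* i
    0<δ : 0ℚ ℚ.< δ
    0<δ = *-pos (*-pos 0<g 0<w) 0<i
    absorb : ∀ q → q ℚ.* (K ℚ.* i) ≡ q
    absorb q = trans (cong (q ℚ.*_) Ki) (ℚ.*-identityʳ q)
    w-e : δ ≡ w ℚ.- e
    w-e = trans (gap g v w i) (cong (ℚ._- e) (absorb w))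
    e²-D : g ℚ.* g ℚ.* i ℚ.+ δ ℚ.* δ ≡ e ℚ.* e ℚ.- D
    e²-D = begin
      g ℚ.* g ℚ.* i ℚ.+ δ ℚ.* δ                              ≡⟨ square-gap g w v i ⟩
      g ℚ.* (K ℚ.* i) ℚ.- v ℚ.* g ℚ.* i ℚ.+ δ ℚ.* δ          ≡⟨ cong₂ (λ k l → k ℚ.- l ℚ.+ δ ℚ.* δ) (absorb g) (double-gap g w i) ⟩
      g ℚ.- (w ℚ.* δ ℚ.+ w ℚ.* δ) ℚ.+ δ ℚ.* δ                ≡⟨ cong (λ k → g ℚ.- (w ℚ.* k ℚ.+ w ℚ.* k) ℚ.+ k ℚ.* k) w-e ⟩
      g ℚ.- (w ℚ.* (w ℚ.- e) ℚ.+ w ℚ.* (w ℚ.- e)) ℚ.+ (w ℚ.- e) ℚ.* (w ℚ.- e) ≡⟨ square-diff D w e ⟩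
      e ℚ.* e ℚ.- D                                          ∎
      where open ≡-Reasoning

-- The cut of the root asks for a rational witness strictly below `w`; `root-below` constructs one.
upper-√⇔ : ∀ D w → ℝ.upper (√ fromℚ D) w ⇔ (0ℚ ℚ.< w × D ℚ.< w ℚ.* w)
upper-√⇔ D w = mk⇔
  (λ (r , r<w , 0<r , D<r²) → ℚ.<-trans 0<r r<w , ℚ.<-trans D<r² (square-< 0<r r<w))
  (λ (0<w , D<w²) → root-below D w 0<w D<w²)

-- Integers among the rationals

/1-mono-≤ : ∀ {i j} → i ℤ.≤ j → i ℚ./ 1 ℚ.≤ j ℚ./ 1
/1-mono-≤ {i} {j} i≤j = ℚ.toℚᵘ-cancel-≤ (ℚᵘ.≤-respʳ-≃ (ℚᵘ.≃-sym (toℚᵘ-/1 j))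
  (ℚᵘ.≤-respˡ-≃ (ℚᵘ.≃-sym (toℚᵘ-/1 i)) (ℚᵘ.*≤* (ℤ.*-monoʳ-≤-nonNeg (+ 1) i≤j))))

/1-cancel-< : ∀ {i j} → i ℚ./ 1 ℚ.< j ℚ./ 1 → i ℤ.< j
/1-cancel-< i<j = ℤ.≰⇒> λ j≤i → ℚ.<-irrefl refl (ℚ.<-≤-trans i<j (/1-mono-≤ j≤i))

/1-mono-< : ∀ {i j} → i ℤ.< j → i ℚ./ 1 ℚ.< j ℚ./ 1
/1-mono-< {i} {j} i<j = ℚ.toℚᵘ-cancel-< (ℚᵘ.<-respʳ-≃ (ℚᵘ.≃-sym (toℚᵘ-/1 j))
  (ℚᵘ.<-respˡ-≃ (ℚᵘ.≃-sym (toℚᵘ-/1 i)) (ℚᵘ.*<* (ℤ.*-monoʳ-<-pos (+ 1) i<j))))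

/1-homo-+ : ∀ i j → (i ℤ.+ j) ℚ./ 1 ≡ i ℚ./ 1 ℚ.+ j ℚ./ 1
/1-homo-+ i j = ℚ.toℚᵘ-injective (begin
  ℚ.toℚᵘ ((i ℤ.+ j) ℚ./ 1)                     ≈⟨ toℚᵘ-/1 (i ℤ.+ j) ⟩
  ℚᵘ.mkℚᵘ (i ℤ.+ j) 0                          ≈⟨ ℚᵘ.*≡* (solve 2 (λ i j → (i :+ j) :* con (+ 1) := (i :* con (+ 1) :+ j :* con (+ 1)) :* con (+ 1)) refl i j) ⟩
  ℚᵘ.mkℚᵘ i 0 ℚᵘ.+ ℚᵘ.mkℚᵘ j 0                 ≈⟨ ℚᵘ.+-cong (toℚᵘ-/1 i) (toℚᵘ-/1 j) ⟨
  ℚ.toℚᵘ (i ℚ./ 1) ℚᵘ.+ ℚ.toℚᵘ (j ℚ./ 1)       ≈⟨ ℚ.toℚᵘ-homo-+ (i ℚ./ 1) (j ℚ./ 1) ⟨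
  ℚ.toℚᵘ (i ℚ./ 1 ℚ.+ j ℚ./ 1)                 ∎)
  where
  open import Relation.Binary.Reasoning.Setoid ℚᵘ.≃-setoid
  open ℤ.+-*-Solver

/1-homo-* : ∀ i j → (i ℤ.* j) ℚ./ 1 ≡ i ℚ./ 1 ℚ.* (j ℚ./ 1)
/1-homo-* i j = ℚ.toℚᵘ-injective (begin
  ℚ.toℚᵘ ((i ℤ.* j) ℚ./ 1)                     ≈⟨ toℚᵘ-/1 (i ℤ.* j) ⟩
  ℚᵘ.mkℚᵘ i 0 ℚᵘ.* ℚᵘ.mkℚᵘ j 0                 ≈⟨ ℚᵘ.*-cong (toℚᵘ-/1 i) (toℚᵘ-/1 j) ⟨
  ℚ.toℚᵘ (i ℚ./ 1) ℚᵘ.* ℚ.toℚᵘ (j ℚ./ 1)       ≈⟨ ℚ.toℚᵘ-homo-* (i ℚ./ 1) (j ℚ./ 1) ⟨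
  ℚ.toℚᵘ (i ℚ./ 1 ℚ.* (j ℚ./ 1))               ∎)
  where open import Relation.Binary.Reasoning.Setoid ℚᵘ.≃-setoid

/1-homo-neg : ∀ i → (ℤ.- i) ℚ./ 1 ≡ ℚ.- (i ℚ./ 1)
/1-homo-neg i = ℚ.toℚᵘ-injective (begin
  ℚ.toℚᵘ ((ℤ.- i) ℚ./ 1)     ≈⟨ toℚᵘ-/1 (ℤ.- i) ⟩
  ℚᵘ.- ℚᵘ.mkℚᵘ i 0           ≈⟨ ℚᵘ.-‿cong (toℚᵘ-/1 i) ⟨
  ℚᵘ.- ℚ.toℚᵘ (i ℚ./ 1)      ≈⟨ ℚ.toℚᵘ-homo‿- (i ℚ./ 1) ⟨
  ℚ.toℚᵘ (ℚ.- (i ℚ./ 1))     ∎)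
  where open import Relation.Binary.Reasoning.Setoid ℚᵘ.≃-setoid

-- Searching for ceilings and floors

least : ∀ {P : ℕ → Set} → (∀ k → Dec (P k)) → ∀ {a} → P a → ∃[ c ] P c × (∀ d → P d → c ℕ.≤ d)
least {P} P? {zero} Pa = 0 , Pa , λ _ _ → ℕ.z≤n
least {P} P? {suc a} Pa with P? 0
... | yes P0 = 0 , P0 , λ _ _ → ℕ.z≤n
... | no ¬P0 with least {P ∘ suc} (P? ∘ suc) Pa
... | c , Pc , c-least = suc c , Pc , λ { zero P0 → contradiction P0 ¬P0 ; (suc d) Pd → ℕ.s≤s (c-least d Pd) }

greatest : ∀ {P : ℕ → Set} → (∀ k → Dec (P k)) → ∀ {n} → P n → ∀ m → (∀ k → P k → k ℕ.≤ m) →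
  ∃[ f ] P f × (∀ k → P k → k ℕ.≤ f)
greatest P? Pn m ≤m with P? m
... | yes Pm = m , Pm , ≤m
greatest {P} P? {n} Pn zero ≤0 | no ¬P0 = contradiction (subst P (ℕ.n≤0⇒n≡0 (≤0 n Pn)) Pn) ¬P0
greatest {P} P? Pn (suc m) ≤1+m | no ¬Pm =
  greatest P? Pn m λ k Pk → ℕ.≤-pred (ℕ.≤∧≢⇒< (≤1+m k Pk) λ { refl → ¬Pm Pk })

≤fromℤ-mono : ∀ x {i j} → i ℤ.≤ j → x ≤ fromℤ i → x ≤ fromℤ j
≤fromℤ-mono x i≤j x≤i q lq = ℚ.<-≤-trans (x≤i q lq) (/1-mono-≤ i≤j)

-- Decidable comparisons allow a search for the least upper bound. As `x ≤ 0` fails, no negative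
-- integer is above `x` and searching the naturals suffices.
ceiling⇔ : ∀ x a → (∀ k → Dec (x ≤ fromℤ (+ k))) → ¬ x ≤ fromℤ (+ 0) →
  (∃[ c ] IsCeiling x c × c ℤ.≤ + a) ⇔ (x ≤ fromℤ (+ a))
ceiling⇔ x a x≤? x≰0 = mk⇔
  (λ (c , (x≤c , _) , c≤a) → ≤fromℤ-mono x {c} {+ a} c≤a x≤c)
  (λ x≤a → let c , x≤c , c-least = least x≤? {a} x≤a in
    + c , (x≤c , bound c-least) , ℤ.+≤+ (c-least a x≤a))
  where
  bound : ∀ {c} → (∀ d → x ≤ fromℤ (+ d) → c ℕ.≤ d) → ∀ d → x ≤ fromℤ d → + c ℤ.≤ d
  bound c-least (+ d) x≤d = ℤ.+≤+ (c-least d x≤d)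
  bound c-least ℤ.-[1+ d ] x≤d = contradiction (≤fromℤ-mono x {ℤ.-[1+ d ]} {+ 0} ℤ.-≤+ x≤d) x≰0

floor⇔ : ∀ x n → (∀ k → Dec (fromℤ (+ k) ≤ x)) →
  (∃[ f ] IsFloor x f × + n ℤ.≤ f) ⇔ (fromℤ (+ n) ≤ x)
floor⇔ x n ≤x? = mk⇔
  (λ (f , (f≤x , _) , n≤f) q q<n → f≤x q (ℚ.<-≤-trans q<n (/1-mono-≤ n≤f)))
  (λ n≤x → let f , f≤x , f-greatest = greatest ≤x? {n} n≤x _ below in
    + f , (f≤x , bound f-greatest) , ℤ.+≤+ (f-greatest n n≤x))
  where
  -- A rational above `x` is at most the absolute value of its numerator, where the downward search
  -- for the floor starts.
  u = proj₁ (ℝ.upper-inhabited x)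
  below : ∀ k → fromℤ (+ k) ≤ x → k ℕ.≤ ℤ.∣ ℚ.↥ u ∣
  below k k≤x = ℕ.≮⇒≥ λ u<k → Equivalence.to (fromℚ≤⇔ (ι k) x) k≤x
    (ℝ.upper-up x (ℚ.≤-<-trans (≤ι∣↥∣ u) (/1-mono-< (ℤ.+<+ u<k))) (proj₂ (ℝ.upper-inhabited x)))
  bound : ∀ {f} → (∀ d → fromℤ (+ d) ≤ x → d ℕ.≤ f) → ∀ d → fromℤ d ≤ x → d ℤ.≤ + f
  bound f-greatest (+ d) d≤x = ℤ.+≤+ (f-greatest d d≤x)
  bound f-greatest ℤ.-[1+ d ] _ = ℤ.-≤+

-- The bounds as integer inequalities

-- The left side minus the right side of the inequality obtained by counting.
quad : ℤ → ℤ → ℤ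
quad n a = n ℤ.* n ℤ.+ + 3 ℤ.* n ℤ.+ a ℤ.* a ℤ.- + 4 ℤ.* a ℤ.* n ℤ.- a

quadℚ : ℚ → ℚ → ℚ
quadℚ n a = n ℚ.* n ℚ.+ ι 3 ℚ.* n ℚ.+ a ℚ.* a ℚ.- ι 4 ℚ.* a ℚ.* n ℚ.- a

/1-homo-- : ∀ i j → (i ℤ.- j) ℚ./ 1 ≡ i ℚ./ 1 ℚ.- j ℚ./ 1
/1-homo-- i j = trans (/1-homo-+ i (ℤ.- j)) (cong (i ℚ./ 1 ℚ.+_) (/1-homo-neg j))

quad/1 : ∀ n a → quad n a ℚ./ 1 ≡ quadℚ (n ℚ./ 1) (a ℚ./ 1)
quad/1 n a =
  trans (/1-homo-- (n ℤ.* n ℤ.+ + 3 ℤ.* n ℤ.+ a ℤ.* a ℤ.- + 4 ℤ.* a ℤ.* n) a) (cong (ℚ._- a ℚ./ 1)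
  (trans (/1-homo-- (n ℤ.* n ℤ.+ + 3 ℤ.* n ℤ.+ a ℤ.* a) (+ 4 ℤ.* a ℤ.* n)) (cong₂ ℚ._-_
    (trans (/1-homo-+ (n ℤ.* n ℤ.+ + 3 ℤ.* n) (a ℤ.* a)) (cong₂ ℚ._+_
      (trans (/1-homo-+ (n ℤ.* n) (+ 3 ℤ.* n)) (cong₂ ℚ._+_ (/1-homo-* n n) (/1-homo-* (+ 3) n)))
      (/1-homo-* a a)))
    (trans (/1-homo-* (+ 4 ℤ.* a) n) (cong (ℚ._* (n ℚ./ 1)) (/1-homo-* (+ 4) a))))))

-- The inequality quad n a ≤ 0 bounds a from below by 2n + ½ − √(3n² − n + ¼)
-- and n from above by 2a − 3/2 + √(3a² − 5a + 9/4); either bound fails iff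
-- quad n a > 0 on the relevant side of the vertex of the parabola.
ApprovalFails VotersFails : ℤ → ℤ → Set
ApprovalFails n a = 0ℤ ℤ.< + 4 ℤ.* n ℤ.+ + 1 ℤ.- + 2 ℤ.* a × 0ℤ ℤ.< quad n a
VotersFails   n a = 0ℤ ℤ.< + 2 ℤ.* n ℤ.- + 4 ℤ.* a ℤ.+ + 3 × 0ℤ ℤ.< quad n a

0<⇔ : ∀ {q} i → q ≡ i ℚ./ 1 → (0ℚ ℚ.< q) ⇔ (0ℤ ℤ.< i)
0<⇔ i refl = mk⇔ (/1-cancel-< {0ℤ} {i}) (/1-mono-< {0ℤ} {i})

-- Doubling clears the halves in the two bounds, so that their linear conditions become integer
-- ones.
0<2*⇔ : ∀ {q} i → ι 2 ℚ.* q ≡ i ℚ./ 1 → (0ℚ ℚ.< q) ⇔ (0ℤ ℤ.< i)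
0<2*⇔ {q} i eq = 0<⇔ i eq ⇔-∘ mk⇔ (*-pos (ℚ.positive⁻¹ (ι 2)))
  (λ 0<2q → ℚ.*-cancelˡ-<-nonNeg (ι 2) (subst (ℚ._< ι 2 ℚ.* q) (sym (ℚ.*-zeroʳ (ι 2))) 0<2q))

<⇔ : ∀ {p q} i → q ℚ.- p ≡ i ℚ./ 1 → (p ℚ.< q) ⇔ (0ℤ ℤ.< i)
<⇔ i eq = 0<⇔ i eq ⇔-∘ mk⇔ <⇒0<- 0<-⇒<

module _ where
  open ℚ.+-*-Solver

  approval-double : ∀ n d → ι 2 ℚ.* (ι 2 ℚ.* n ℚ.+ ½ ℚ.- d) ≡ ι 4 ℚ.* n ℚ.+ ι 1 ℚ.- ι 2 ℚ.* d
  approval-double = solve 2 (λ n d → con (ι 2) :* (con (ι 2) :* n :+ con ½ :- d)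
    := con (ι 4) :* n :+ con (ι 1) :- con (ι 2) :* d) refl

  -- Completes the square of `quadℚ n d` in `d`; what is subtracted is the radicand of
  -- `approvalBound`.
  approval-square : ∀ n d → (ι 2 ℚ.* n ℚ.+ ½ ℚ.- d) ℚ.* (ι 2 ℚ.* n ℚ.+ ½ ℚ.- d)
    ℚ.- (ι 3 ℚ.* (n ℚ.* n) ℚ.- n ℚ.+ + 1 ℚ./ 4) ≡ quadℚ n d
  approval-square = solve 2 (λ n d → (con (ι 2) :* n :+ con ½ :- d) :* (con (ι 2) :* n :+ con ½ :- d)
    :- (con (ι 3) :* (n :* n) :- n :+ con (+ 1 ℚ./ 4))
    := n :* n :+ con (ι 3) :* n :+ d :* d :- con (ι 4) :* d :* n :- d) refl

  voters-double : ∀ n a → ι 2 ℚ.* (n ℚ.- (ι 2 ℚ.* a ℚ.- + 3 ℚ./ 2)) ≡ ι 2 ℚ.* n ℚ.- ι 4 ℚ.* a ℚ.+ ι 3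
  voters-double = solve 2 (λ n a → con (ι 2) :* (n :- (con (ι 2) :* a :- con (+ 3 ℚ./ 2)))
    := con (ι 2) :* n :- con (ι 4) :* a :+ con (ι 3)) refl

  -- The same polynomial with the square completed in `n`, which gives the radicand of
  -- `votersBound`.
  voters-square : ∀ n a → (n ℚ.- (ι 2 ℚ.* a ℚ.- + 3 ℚ./ 2)) ℚ.* (n ℚ.- (ι 2 ℚ.* a ℚ.- + 3 ℚ./ 2))
    ℚ.- (ι 3 ℚ.* (a ℚ.* a) ℚ.- ι 5 ℚ.* a ℚ.+ + 9 ℚ./ 4) ≡ quadℚ n a
  voters-square = solve 2 (λ n a → (n :- (con (ι 2) :* a :- con (+ 3 ℚ./ 2))) :* (n :- (con (ι 2) :* a :- con (+ 3 ℚ./ 2)))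
    :- (con (ι 3) :* (a :* a) :- con (ι 5) :* a :+ con (+ 9 ℚ./ 4))
    := n :* n :+ con (ι 3) :* n :+ a :* a :- con (ι 4) :* a :* n :- a) refl

approvalBound≤⇔ : ∀ n d → approvalBound n ≤ fromℤ d ⇔ (¬ ApprovalFails (+ n) d)
approvalBound≤⇔ n d = ¬-cong-⇔
  ((0<2*⇔ (+ 4 ℤ.* + n ℤ.+ + 1 ℤ.- + 2 ℤ.* d) (trans (approval-double N δ) (sym double))
      ×-⇔ <⇔ (quad (+ n) d) (trans (approval-square N δ) (sym (quad/1 (+ n) d))))
    ⇔-∘ (upper-√⇔ _ _ ⇔-∘ lower-fromℚ-⇔ (ι 2 ℚ.* N ℚ.+ ½) (√ fromℚ (ι 3 ℚ.* (N ℚ.* N) ℚ.- N ℚ.+ + 1 ℚ./ 4)) δ))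
  ⇔-∘ ≤fromℚ⇔ (approvalBound n) δ
  where
  N = ι n
  δ = d ℚ./ 1
  double : (+ 4 ℤ.* + n ℤ.+ + 1 ℤ.- + 2 ℤ.* d) ℚ./ 1 ≡ ι 4 ℚ.* N ℚ.+ ι 1 ℚ.- ι 2 ℚ.* δ
  double = trans (/1-homo-- (+ 4 ℤ.* + n ℤ.+ + 1) (+ 2 ℤ.* d)) (cong₂ ℚ._-_
    (trans (/1-homo-+ (+ 4 ℤ.* + n) (+ 1)) (cong (ℚ._+ ι 1) (/1-homo-* (+ 4) (+ n))))
    (/1-homo-* (+ 2) d))

≤votersBound⇔ : ∀ n a → fromℤ n ≤ votersBound a ⇔ (¬ VotersFails n (+ a))
≤votersBound⇔ n a = ¬-cong-⇔
  ((0<2*⇔ (+ 2 ℤ.* n ℤ.- + 4 ℤ.* + a ℤ.+ + 3) (trans (voters-double N A) (sym double))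
      ×-⇔ <⇔ (quad n (+ a)) (trans (voters-square N A) (sym (quad/1 n (+ a)))))
    ⇔-∘ (upper-√⇔ _ _ ⇔-∘ upper-fromℚ+⇔ (ι 2 ℚ.* A ℚ.- + 3 ℚ./ 2) (√ fromℚ (ι 3 ℚ.* (A ℚ.* A) ℚ.- ι 5 ℚ.* A ℚ.+ + 9 ℚ./ 4)) N))
  ⇔-∘ fromℚ≤⇔ N (votersBound a)
  where
  N = n ℚ./ 1
  A = ι a
  double : (+ 2 ℤ.* n ℤ.- + 4 ℤ.* + a ℤ.+ + 3) ℚ./ 1 ≡ ι 2 ℚ.* N ℚ.- ι 4 ℚ.* A ℚ.+ ι 3
  double = trans (/1-homo-+ (+ 2 ℤ.* n ℤ.- + 4 ℤ.* + a) (+ 3)) (cong (ℚ._+ ι 3)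
    (trans (/1-homo-- (+ 2 ℤ.* n) (+ 4 ℤ.* + a)) (cong₂ ℚ._-_ (/1-homo-* (+ 2) n) (/1-homo-* (+ 4) (+ a)))))

¬bothPositive? : ∀ i j → Dec (¬ (0ℤ ℤ.< i × 0ℤ ℤ.< j))
¬bothPositive? i j = ¬? ((0ℤ ℤ.<? i) ×-dec (0ℤ ℤ.<? j))

*-nonNeg : ∀ {i j} → 0ℤ ℤ.≤ i → 0ℤ ℤ.≤ j → 0ℤ ℤ.≤ i ℤ.* j
*-nonNeg {i} {j} 0≤i 0≤j = subst (ℤ._≤ i ℤ.* j) (ℤ.*-zeroʳ i)
  (ℤ.*-monoˡ-≤-nonNeg i {{ℤ.nonNegative 0≤i}} 0≤j)

0≤+ : ∀ k → 0ℤ ℤ.≤ + k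
0≤+ k = ℤ.+≤+ ℕ.z≤n

0<+suc : ∀ k → 0ℤ ℤ.< + suc k
0<+suc k = ℤ.+<+ (ℕ.s≤s ℕ.z≤n)

-- Shows that the approval bound is positive, as `ceiling⇔` requires. With `n = 1 + m` both
-- quantities become a positive constant plus nonnegative terms.
approvalFails-0 : ∀ n .{{_ : NonZero n}} → ApprovalFails (+ n) (+ 0)
approvalFails-0 (suc m) =
    subst (0ℤ ℤ.<_) (solve 1 (λ m → con (+ 5) :+ con (+ 4) :* m
        := con (+ 4) :* (con (+ 1) :+ m) :+ con (+ 1) :- con (+ 2) :* con 0ℤ) refl (+ m))
      (ℤ.+-mono-<-≤ (0<+suc 4) 0≤4m)
  , subst (0ℤ ℤ.<_) (solve 1 (λ m → con (+ 4) :+ con (+ 4) :* m :+ (m :* m :+ m)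
        := (con (+ 1) :+ m) :* (con (+ 1) :+ m) :+ con (+ 3) :* (con (+ 1) :+ m) :+ con 0ℤ :* con 0ℤ
           :- con (+ 4) :* con 0ℤ :* (con (+ 1) :+ m) :- con 0ℤ) refl (+ m))
      (ℤ.+-mono-<-≤ (ℤ.+-mono-<-≤ (0<+suc 3) 0≤4m) (ℤ.+-mono-≤ (*-nonNeg (0≤+ m) (0≤+ m)) (0≤+ m)))
  where
  open ℤ.+-*-Solver
  0≤4m = *-nonNeg (0≤+ 4) (0≤+ m)

-- Let `x = 4n + 1 - 2a` and `v = 2n - 4a + 3`. Then `8 quad - x v = -(3 + 2m + 10b + 12mb)` with
-- `m = n - 1` and `b = a - 1`, so positive `x` and `quad` exclude `v ≤ 0`.
approval⇒voters : ∀ n a .{{_ : NonZero n}} .{{_ : NonZero a}} →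
  ApprovalFails (+ n) (+ a) → VotersFails (+ n) (+ a)
approval⇒voters (suc m) (suc b) (0<x , 0<quad) = ℤ.≰⇒> (λ v≤0 →
    ℤ.<-irrefl refl (subst (0ℤ ℤ.<_) (identity (+ m) (+ b))
      (ℤ.+-mono-<-≤ (ℤ.+-mono-<-≤ 0<8quad (*-nonNeg (ℤ.<⇒≤ 0<x) (ℤ.neg-mono-≤ v≤0)))
        (ℤ.+-mono-≤ (0≤+ 3) (ℤ.+-mono-≤ (*-nonNeg (0≤+ 2) (0≤+ m)) (ℤ.+-mono-≤ (*-nonNeg (0≤+ 10) (0≤+ b))
          (*-nonNeg (0≤+ 12) (*-nonNeg (0≤+ m) (0≤+ b)))))))))
  , 0<quad
  where
  open ℤ.+-*-Solver
  0<8quad : 0ℤ ℤ.< + 8 ℤ.* quad (+ suc m) (+ suc b)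
  0<8quad = ℤ.*-monoˡ-<-pos (+ 8) 0<quad
  identity : ∀ m b → let n = + 1 ℤ.+ m ; a = + 1 ℤ.+ b in
    + 8 ℤ.* quad n a ℤ.+ (+ 4 ℤ.* n ℤ.+ + 1 ℤ.- + 2 ℤ.* a) ℤ.* (ℤ.- (+ 2 ℤ.* n ℤ.- + 4 ℤ.* a ℤ.+ + 3))
      ℤ.+ (+ 3 ℤ.+ (+ 2 ℤ.* m ℤ.+ (+ 10 ℤ.* b ℤ.+ + 12 ℤ.* (m ℤ.* b)))) ≡ 0ℤ
  identity = solve 2 (λ m b → let n = con (+ 1) :+ m ; a = con (+ 1) :+ b in
    con (+ 8) :* (n :* n :+ con (+ 3) :* n :+ a :* a :- con (+ 4) :* a :* n :- a)
      :+ (con (+ 4) :* n :+ con (+ 1) :- con (+ 2) :* a) :* (:- (con (+ 2) :* n :- con (+ 4) :* a :+ con (+ 3)))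
      :+ (con (+ 3) :+ (con (+ 2) :* m :+ (con (+ 10) :* b :+ con (+ 12) :* (m :* b)))) := con 0ℤ) refl

-- In the same notation `2x = v + (6n - 1)`, so `x` is positive when `v` is.
voters⇒approval : ∀ n a .{{_ : NonZero n}} → VotersFails (+ n) (+ a) → ApprovalFails (+ n) (+ a)
voters⇒approval (suc m) a (0<v , 0<quad) =
  ℤ.*-cancelˡ-<-nonNeg (+ 2) (subst (0ℤ ℤ.<_) (identity (+ m) (+ a))
    (ℤ.+-mono-<-≤ 0<v (ℤ.+-mono-≤ (0≤+ 5) (*-nonNeg (0≤+ 6) (0≤+ m)))))
  , 0<quad
  where
  open ℤ.+-*-Solver
  identity : ∀ m a → let n = + 1 ℤ.+ m in + 2 ℤ.* n ℤ.- + 4 ℤ.* a ℤ.+ + 3 ℤ.+ (+ 5 ℤ.+ + 6 ℤ.* m)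
    ≡ + 2 ℤ.* (+ 4 ℤ.* n ℤ.+ + 1 ℤ.- + 2 ℤ.* a)
  identity = solve 2 (λ m a → let n = con (+ 1) :+ m in
    con (+ 2) :* n :- con (+ 4) :* a :+ con (+ 3) :+ (con (+ 5) :+ con (+ 6) :* m)
      := con (+ 2) :* (con (+ 4) :* n :+ con (+ 1) :- con (+ 2) :* a)) refl

approvalInequality⇔ : ∀ n a .{{_ : NonZero n}} → ApprovalInequality n a ⇔ (¬ ApprovalFails (+ n) (+ a))
approvalInequality⇔ n a = approvalBound≤⇔ n (+ a) ⇔-∘ ceiling⇔ (approvalBound n) a
  (λ k → map-dec (⇔-sym (approvalBound≤⇔ n (+ k))) (¬bothPositive? _ _))
  (λ bound≤0 → Equivalence.to (approvalBound≤⇔ n (+ 0)) bound≤0 (approvalFails-0 n))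

votersInequality⇔ : ∀ n a → VotersInequality n a ⇔ (¬ VotersFails (+ n) (+ a))
votersInequality⇔ n a = ≤votersBound⇔ (+ n) a ⇔-∘ floor⇔ (votersBound a) n
  (λ k → map-dec (⇔-sym (≤votersBound⇔ (+ k) a)) (¬bothPositive? _ _))

quad≤0 : ∀ n a → n ℕ.* n ℕ.+ 3 ℕ.* n ℕ.+ a ℕ.* a ℕ.≤ 4 ℕ.* a ℕ.* n ℕ.+ a → quad (+ n) (+ a) ℤ.≤ 0ℤ
quad≤0 n a bound = subst (ℤ._≤ 0ℤ) eq (ℤ.i≤j⇒i-j≤0 (ℤ.+≤+ bound))
  where
  open ℤ.+-*-Solver
  eq : + (n ℕ.* n ℕ.+ 3 ℕ.* n ℕ.+ a ℕ.* a) ℤ.- + (4 ℕ.* a ℕ.* n ℕ.+ a) ≡ quad (+ n) (+ a)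
  eq = trans (cong₂ ℤ._-_
      (cong₂ ℤ._+_ (cong₂ ℤ._+_ (ℤ.pos-* n n) (ℤ.pos-* 3 n)) (ℤ.pos-* a a))
      (cong (ℤ._+ + a) (trans (ℤ.pos-* (4 ℕ.* a) n) (cong (ℤ._* + n) (ℤ.pos-* 4 a)))))
    (solve 2 (λ n a → (n :* n :+ con (+ 3) :* n :+ a :* a) :- (con (+ 4) :* a :* n :+ a)
      := n :* n :+ con (+ 3) :* n :+ a :* a :- con (+ 4) :* a :* n :- a) refl (+ n) (+ a))

-- The approval ratio

/-*-cancel : ∀ a n .{{_ : NonZero n}} → (+ a ℚ./ n) ℚ.* ι n ≡ ι a
/-*-cancel a (suc m) = ℚ.toℚᵘ-injective (begin
  ℚ.toℚᵘ ((+ a ℚ./ suc m) ℚ.* ι (suc m))                  ≈⟨ ℚ.toℚᵘ-homo-* (+ a ℚ./ suc m) (ι (suc m)) ⟩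
  ℚ.toℚᵘ (+ a ℚ./ suc m) ℚᵘ.* ℚ.toℚᵘ (ι (suc m))          ≈⟨ ℚᵘ.*-cong (ℚ.toℚᵘ-fromℚᵘ (ℚᵘ.mkℚᵘ (+ a) m)) (toℚᵘ-/1 (+ suc m)) ⟩
  ℚᵘ.mkℚᵘ (+ a) m ℚᵘ.* ℚᵘ.mkℚᵘ (+ suc m) 0                ≈⟨ ℚᵘ.*≡* (trans (ℤ.*-identityʳ (+ a ℤ.* + suc m)) (cong (λ k → + a ℤ.* + suc k) (sym (ℕ.*-identityʳ m)))) ⟩
  ℚᵘ.mkℚᵘ (+ a) 0                                         ≈⟨ toℚᵘ-/1 (+ a) ⟨
  ℚ.toℚᵘ (ι a)                                            ∎)
  where
  open import Relation.Binary.Reasoning.Setoid ℚᵘ.≃-setoid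

ι-* : ∀ m n → ι (m ℕ.* n) ≡ ι m ℚ.* ι n
ι-* m n = trans (cong (ℚ._/ 1) (ℤ.pos-* m n)) (/1-homo-* (+ m) (+ n))

≤⇒0≤- : ∀ {p q} → p ℚ.≤ q → 0ℚ ℚ.≤ q ℚ.- p
≤⇒0≤- {p} {q} p≤q = subst (ℚ._≤ q ℚ.- p) (ℚ.+-inverseʳ p) (ℚ.+-monoˡ-≤ (ℚ.- p) p≤q)

*-nonNegℚ : ∀ {p q} → 0ℚ ℚ.≤ p → 0ℚ ℚ.≤ q → 0ℚ ℚ.≤ p ℚ.* q
*-nonNegℚ {p} {q} 0≤p 0≤q = subst (ℚ._≤ p ℚ.* q) (ℚ.*-zeroʳ p) (ℚ.*-monoˡ-≤-nonNeg p {{ℚ.nonNegative 0≤p}} 0≤q)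

0≤-square : ∀ q → 0ℚ ℚ.≤ q ℚ.* q
0≤-square q with ℚ.≤-total 0ℚ q
... | inj₁ 0≤q = *-nonNegℚ 0≤q 0≤q
... | inj₂ q≤0 = subst (0ℚ ℚ.≤_) (solve 1 (λ q → (:- q) :* (:- q) := q :* q) refl q)
  (*-nonNegℚ (ℚ.neg-antimono-≤ q≤0) (ℚ.neg-antimono-≤ q≤0))
  where open ℚ.+-*-Solver

-- Different occurrences of `√3` in the ratio bound yield different rationals above it; this merges
-- two of them.
upper-⊓ : ∀ x {u v} → ℝ.upper x u → ℝ.upper x v → ∃[ w ] w ℚ.≤ u × w ℚ.≤ v × ℝ.upper x w
upper-⊓ x {u} {v} xu xv with ℚ.≤-total u v
... | inj₁ u≤v = u , ℚ.≤-refl , u≤v , xu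
... | inj₂ v≤u = v , v≤u , ℚ.≤-refl , xv

module _ where
  open ℚ.+-*-Solver

  -- The weights `24n²`, `4n` and `1` on the three inequalities of `lower-ratioBound` eliminate `s`
  -- and `t`.
  cleared : ∀ n q s t u →
    ι 24 ℚ.* (n ℚ.* n) ℚ.* ((ι 2 ℚ.- u) ℚ.+ s ℚ.+ t ℚ.- q)
      ℚ.+ ι 4 ℚ.* n ℚ.* ((ι 3 ℚ.+ u) ℚ.- s ℚ.* (ι 6 ℚ.* n))
      ℚ.+ ((ℚ.- t) ℚ.* (ι 24 ℚ.* (n ℚ.* n)) ℚ.- u)
    ≡ ι 24 ℚ.* n ℚ.* (ι 2 ℚ.* n ℚ.+ ½ ℚ.- q ℚ.* n) ℚ.- u ℚ.* (ι 24 ℚ.* (n ℚ.* n) ℚ.- ι 4 ℚ.* n ℚ.+ 1ℚ)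
  cleared = solve 5 (λ n q s t u →
    con (ι 24) :* (n :* n) :* ((con (ι 2) :- u) :+ s :+ t :- q)
      :+ con (ι 4) :* n :* ((con (ι 3) :+ u) :- s :* (con (ι 6) :* n))
      :+ ((:- t) :* (con (ι 24) :* (n :* n)) :- u)
    := con (ι 24) :* n :* (con (ι 2) :* n :+ con ½ :- q :* n)
       :- u :* (con (ι 24) :* (n :* n) :- con (ι 4) :* n :+ con 1ℚ)) refl

  scale-positive : ∀ n → ι 20 ℚ.* (n ℚ.* n) ℚ.+ (ι 2 ℚ.* n ℚ.- 1ℚ) ℚ.* (ι 2 ℚ.* n ℚ.- 1ℚ)
    ≡ ι 24 ℚ.* (n ℚ.* n) ℚ.- ι 4 ℚ.* n ℚ.+ 1ℚ
  scale-positive = solve 1 (λ n → con (ι 20) :* (n :* n) :+ (con (ι 2) :* n :- con 1ℚ) :* (con (ι 2) :* n :- con 1ℚ)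
    := con (ι 24) :* (n :* n) :- con (ι 4) :* n :+ con 1ℚ) refl

  -- The factor `w + uk` is written as `(w - uk) + 2uk`, so that every term is visibly positive once
  -- `w > uk` and `u² > 3`.
  difference-of-squares : ∀ w u k → (w ℚ.- u ℚ.* k) ℚ.* ((w ℚ.- u ℚ.* k) ℚ.+ ι 2 ℚ.* (u ℚ.* k)) ℚ.+ (u ℚ.* u ℚ.- ι 3) ℚ.* (k ℚ.* k)
    ≡ w ℚ.* w ℚ.- ι 3 ℚ.* (k ℚ.* k)
  difference-of-squares = solve 3 (λ w u k →
    (w :- u :* k) :* ((w :- u :* k) :+ con (ι 2) :* (u :* k)) :+ (u :* u :- con (ι 3)) :* (k :* k)
    := w :* w :- con (ι 3) :* (k :* k)) refl

  -- By `approval-square`, `w²` is `576n²` times the sum of `quadℚ n a` and the radicand of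
  -- `approvalBound`; the final square is what `3k²` has beyond the radicand's share.
  discrepancy : ∀ n a → let w = ι 24 ℚ.* n ℚ.* (ι 2 ℚ.* n ℚ.+ ½ ℚ.- a) ; k = ι 24 ℚ.* (n ℚ.* n) ℚ.- ι 4 ℚ.* n ℚ.+ 1ℚ in
    (w ℚ.* w ℚ.- ι 3 ℚ.* (k ℚ.* k)) ℚ.+ (ι 576 ℚ.* (n ℚ.* n) ℚ.* (0ℚ ℚ.- quadℚ n a)
      ℚ.+ ι 3 ℚ.* ((ι 4 ℚ.* n ℚ.- 1ℚ) ℚ.* (ι 4 ℚ.* n ℚ.- 1ℚ))) ≡ 0ℚ
  discrepancy = solve 2 (λ n a →
    let w = con (ι 24) :* n :* (con (ι 2) :* n :+ con ½ :- a)
        k = con (ι 24) :* (n :* n) :- con (ι 4) :* n :+ con 1ℚ in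
    (w :* w :- con (ι 3) :* (k :* k))
      :+ (con (ι 576) :* (n :* n) :* (con 0ℚ :- (n :* n :+ con (ι 3) :* n :+ a :* a :- con (ι 4) :* a :* n :- a))
      :+ con (ι 3) :* ((con (ι 4) :* n :- con 1ℚ) :* (con (ι 4) :* n :- con 1ℚ))) := con 0ℚ) refl

ι-nonNeg : ∀ n → 0ℚ ℚ.≤ ι n
ι-nonNeg n = /1-mono-≤ {0ℤ} {+ n} (0≤+ n)

-- Multiplied by 24n², a violated ratio bound says u·(24n² − 4n + 1) < 24n(2n + ½ − a)
-- for some rational u > √3; squaring contradicts quad n a ≤ 0, because
-- 3(24n² − 4n + 1)² − 576n²(3n² − n + ¼) = 3(4n − 1)².
ratio-gap : ∀ n a u → 0ℚ ℚ.< n → quadℚ n a ℚ.≤ 0ℚ → 0ℚ ℚ.< u → ι 3 ℚ.< u ℚ.* u →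
  ¬ 0ℚ ℚ.< ι 24 ℚ.* n ℚ.* (ι 2 ℚ.* n ℚ.+ ½ ℚ.- a) ℚ.- u ℚ.* (ι 24 ℚ.* (n ℚ.* n) ℚ.- ι 4 ℚ.* n ℚ.+ 1ℚ)
ratio-gap n a u 0<n quad≤0 0<u 3<u² 0<gap = ℚ.<-irrefl refl (subst (0ℚ ℚ.<_) (discrepancy n a)
  (ℚ.+-mono-<-≤
    (subst (0ℚ ℚ.<_) (difference-of-squares w u k) (ℚ.+-mono-<
      (*-pos 0<gap (ℚ.+-mono-< 0<gap (*-pos (ℚ.positive⁻¹ (ι 2)) (*-pos 0<u 0<k))))
      (*-pos (<⇒0<- 3<u²) (*-pos 0<k 0<k))))
    (ℚ.+-mono-≤
      (*-nonNegℚ (*-nonNegℚ (ι-nonNeg 576) (0≤-square n)) (≤⇒0≤- quad≤0))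
      (*-nonNegℚ (ι-nonNeg 3) (0≤-square (ι 4 ℚ.* n ℚ.- 1ℚ))))))
  where
  w = ι 24 ℚ.* n ℚ.* (ι 2 ℚ.* n ℚ.+ ½ ℚ.- a)
  k = ι 24 ℚ.* (n ℚ.* n) ℚ.- ι 4 ℚ.* n ℚ.+ 1ℚ
  0<k : 0ℚ ℚ.< k
  0<k = subst (0ℚ ℚ.<_) (scale-positive n) (ℚ.+-mono-<-≤ (*-pos (ℚ.positive⁻¹ (ι 20)) (*-pos 0<n 0<n))
    (0≤-square (ι 2 ℚ.* n ℚ.- 1ℚ)))

-- Here `s` approximates `(3 + √3)/6n` and `t` approximates `-√3/24n²`, both from below, while the
-- single `u` replaces all three occurrences of `√3`.
lower-ratioBound : ∀ n .{{_ : NonZero n}} q → ℝ.lower (ratioBound n) q → ∃[ s ] ∃[ t ] ∃[ u ]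
  0ℚ ℚ.< u × ι 3 ℚ.< u ℚ.* u × q ℚ.< (ι 2 ℚ.- u) ℚ.+ s ℚ.+ t
    × s ℚ.* (ι 6 ℚ.* ι n) ℚ.< ι 3 ℚ.+ u × u ℚ.≤ (ℚ.- t) ℚ.* (ι 24 ℚ.* (ι n ℚ.* ι n))
lower-ratioBound n q
  (r , t , (r₁ , s , r₁<2-√3 , (c , d , c<3 , d<√3 , s·6n<c+d) , r<r₁+s) , √3<-t·24n² , q<r+t)
  = let √3<2-r₁ = Equivalence.to (lower-fromℚ-⇔ (ι 2) √3 r₁) r₁<2-√3
        u , u≤2-r₁ , u≤-t·24n² , √3<u = upper-⊓ √3 {ι 2 ℚ.- r₁} {(ℚ.- t) ℚ.* ι (24 ℕ.* (n ℕ.* n))} √3<2-r₁ √3<-t·24n²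
        0<u , 3<u² = Equivalence.to (upper-√⇔ (ι 3) u) √3<u
    in s , t , u , 0<u , 3<u²
     , ℚ.<-trans q<r+t (ℚ.+-monoˡ-< t (ℚ.<-≤-trans r<r₁+s (ℚ.+-monoˡ-≤ s (r₁≤2-u r₁ u u≤2-r₁))))
     , subst (λ k → s ℚ.* k ℚ.< ι 3 ℚ.+ u) (ι-* 6 n)
         (ℚ.<-trans s·6n<c+d (ℚ.+-mono-< c<3 (lower<upper √3 d<√3 √3<u)))
     , subst (λ k → u ℚ.≤ (ℚ.- t) ℚ.* k) (trans (ι-* 24 (n ℕ.* n)) (cong (ι 24 ℚ.*_) (ι-* n n))) u≤-t·24n²
  where
  √3 = √ fromℤ (+ 3)
  flip-minus : ∀ r u → (ι 2 ℚ.- r) ℚ.+ (r ℚ.- u) ≡ ι 2 ℚ.- u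
  flip-minus = solve 2 (λ r u → (con (ι 2) :- r) :+ (r :- u) := con (ι 2) :- u) refl
    where open ℚ.+-*-Solver
  flip-plus : ∀ r u → u ℚ.+ (r ℚ.- u) ≡ r
  flip-plus = solve 2 (λ r u → u :+ (r :- u) := r) refl
    where open ℚ.+-*-Solver
  r₁≤2-u : ∀ r₁ u → u ℚ.≤ ι 2 ℚ.- r₁ → r₁ ℚ.≤ ι 2 ℚ.- u
  r₁≤2-u r₁ u u≤2-r₁ = subst₂ ℚ._≤_ (flip-plus r₁ u) (flip-minus r₁ u) (ℚ.+-monoˡ-≤ (r₁ ℚ.- u) u≤2-r₁)

ratioInequality : ∀ n a .{{_ : NonZero n}} → quad (+ n) (+ a) ℤ.≤ 0ℤ → RatioInequality n a
ratioInequality n a quad≤0 = Equivalence.from (≤fromℚ⇔ (ratioBound n) q) λ lq →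
  let s , t , u , 0<u , 3<u² , q< , s< , u≤ = lower-ratioBound n q lq in
  ratio-gap (ι n) (ι a) u 0<n (subst (ℚ._≤ 0ℚ) (quad/1 (+ n) (+ a)) (/1-mono-≤ {_} {0ℤ} quad≤0)) 0<u 3<u²
    (subst (λ k → 0ℚ ℚ.< ι 24 ℚ.* ι n ℚ.* (ι 2 ℚ.* ι n ℚ.+ ½ ℚ.- k) ℚ.- u ℚ.* (ι 24 ℚ.* (ι n ℚ.* ι n) ℚ.- ι 4 ℚ.* ι n ℚ.+ 1ℚ))
      (/-*-cancel a n)
      (subst (0ℚ ℚ.<_) (cleared (ι n) q s t u)
        (ℚ.+-mono-<-≤
          (ℚ.+-mono-< (*-pos (*-pos (ℚ.positive⁻¹ (ι 24)) (*-pos 0<n 0<n)) (<⇒0<- q<))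
            (*-pos (*-pos (ℚ.positive⁻¹ (ι 4)) 0<n) (<⇒0<- s<)))
          (≤⇒0≤- u≤))))
  where
  q = + a ℚ./ n
  0<n : 0ℚ ℚ.< ι n
  0<n = ℚ.positive⁻¹ (ι n) {{ι-positive n}}

theorem4p1 : (∀ (n : ℕ) .{{_ : NonZero n}} (S : Society n) (a : ℕ) →
                PairwiseIntersecting S → ApprovalNumber S a →
                ApprovalInequality n a × RatioInequality n a × VotersInequality n a)
           × (∀ (n a : ℕ) .{{_ : NonZero n}} .{{_ : NonZero a}} →
                ApprovalInequality n a ⇔ VotersInequality n a)
theorem4p1 =
    (λ n S a intersecting approval →
      let bound = quad≤0 n a (quadratic-bound S intersecting approval) in
        Equivalence.from (approvalInequality⇔ n a) (λ (_ , 0<quad) → ℤ.<⇒≱ 0<quad bound)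
      , ratioInequality n a bound
      , Equivalence.from (votersInequality⇔ n a) (λ (_ , 0<quad) → ℤ.<⇒≱ 0<quad bound))
  -- Each inequality is the negation of its failure condition, so the implications between failures
  -- are used contrapositively.
  , λ n a → mk⇔
      (λ approval → Equivalence.from (votersInequality⇔ n a)
        (Equivalence.to (approvalInequality⇔ n a) approval ∘ voters⇒approval n a))
      (λ voters → Equivalence.from (approvalInequality⇔ n a)
        (Equivalence.to (votersInequality⇔ n a) voters ∘ approval⇒voters n a))
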